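{- The relation $\mathtt{Sat}_{\Delta_0}(x,y)$ on $\mathbb{N}$ is primitive recursive.
   Context: $\mathbb{N}$ contains $0$ and also denotes the standard model of arithmetic. A relation $R\subseteq\mathbb{N}^n$ is primitive recursive if its characteristic function $\chi_R\colon\mathbb{N}^n\to\{0,1\}$ (equal to $1$ exactly on $R$) is a primitive recursive function, i.e. belongs to the smallest class of functions containing the constant zero function, the successor function and the projections, and closed under composition and primitive recursion. Formulas are first-order formulas in the language $\langle 0,1,+,\times,\leqslant\rangle$ with equality and variables $v_0,v_1,v_2,\ldots$. Bounded formulas. A formula is bounded (a $\Delta_0$-formula) if it is constructed from atomic formulas $t=s$, $t\leqslant s$ ($t,s$ terms) by means of negation, conjunction, disjunction, implication and bounded quantifications $\forall x\leqslant t$, $\exists x\leqslant t$, where $t$ is a term in which the variable $x$ does not occur; $\forall x\leqslant t\,\mathcal{A}$ abbreviates $\forall x[x\leqslant t\rightarrow\mathcal{A}]$ and $\exists x\leqslant t\,\mathcal{A}$ abbreviates $\exists x[x\leqslant t\wedge\mathcal{A}]$. Gödel coding. Fix a Gödel coding $\alpha\mapsto\ulcorner\alpha\urcorner\in\mathbb{N}$ of terms and formulas which is primitive recursive in the usual sense: it is injective; the set of codes of variables is primitive recursive and the passages from $i$ to $\ulcorner v_i\urcorner$ and back are primitive recursive; the codes of $t+s$, $t\times s$, $t=s$, $t\leqslant s$, $\neg A$, $A\wedge B$, $A\vee B$, $A\rightarrow B$, $\forall x\leqslant t\,A$, $\exists x\leqslant t\,A$ are given by primitive recursive functions of the codes of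 the constituents (terms $t,s$, formulas $A,B$, variable $x$), and are strictly greater than the codes of these constituents. Satisfaction. $\mathtt{Sat}_{\Delta_0}$ is the set of all ordered pairs $(\ulcorner\theta(\vec\nu)\urcorner,a)$ where $\theta(\vec\nu)$ is a $\Delta_0$-formula with free variables $\vec\nu$, $a\in\mathbb{N}$, and $\mathbb{N}\models\theta(\vec a)$, i.e. the sentence resulting from substituting (the numeral of) the single number $a$ for every free variable of $\theta$ is true in $\mathbb{N}$. -}

module Defs where

open import Data.Bool using (if_then_else_)
open import Data.Empty using (⊥)
open import Data.Fin using (Fin)
open import Data.Nat using (ℕ; zero; suc; _+_; _*_; _≤_; _<_; _≟_)
open import Data.Product using (∃-syntax; _×_)
open import Data.Sum using (_⊎_; inj₁; inj₂)
open import Data.Vec using (Vec; []; _∷_; head; lookup)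
open import Function.Bundles using (_⇔_)
open import Function.Definitions using (Injective)
open import Relation.Binary.PropositionalEquality using (_≡_)
open import Relation.Nullary using (¬_; does)

-- Derivations of n-ary primitive recursive functions.  Composition with an
-- empty vector of inner functions gives the constant functions of any arity.
data PrimRec : ℕ → Set where
  zeroᵖ : PrimRec 0
  sucᵖ  : PrimRec 1
  projᵖ : ∀ {n} → Fin n → PrimRec n
  compᵖ : ∀ {m n} → PrimRec m → Vec (PrimRec n) m → PrimRec n
  recᵖ  : ∀ {n} → PrimRec n → PrimRec (suc (suc n)) → PrimRec (suc n)

mutual
  eval : ∀ {n} → PrimRec n → Vec ℕ n → ℕ
  eval zeroᵖ        []           = 0
  eval sucᵖ         (x ∷ [])     = suc x
  eval (projᵖ i)    xs           = lookup xs i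
  eval (compᵖ f gs) xs           = eval f (evals gs xs)
  eval (recᵖ g h)   (zero  ∷ xs) = eval g xs
  eval (recᵖ g h)   (suc k ∷ xs) = eval h (k ∷ eval (recᵖ g h) (k ∷ xs) ∷ xs)

  evals : ∀ {m n} → Vec (PrimRec n) m → Vec ℕ n → Vec ℕ m
  evals []       xs = []
  evals (g ∷ gs) xs = eval g xs ∷ evals gs xs

PrimitiveRecursive : ∀ {n} → (Vec ℕ n → ℕ) → Set
PrimitiveRecursive {n} f = ∃[ p ] (∀ (xs : Vec ℕ n) → eval p xs ≡ f xs)

IsCharacteristicFunction : ∀ {n} → (Vec ℕ n → Set) → (Vec ℕ n → ℕ) → Set
IsCharacteristicFunction R χ = ∀ xs → (χ xs ≡ 0 ⊎ χ xs ≡ 1) × (χ xs ≡ 1 ⇔ R xs)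

PrimitiveRecursiveRelation : ∀ {n} → (Vec ℕ n → Set) → Set
PrimitiveRecursiveRelation R =
  ∃[ χ ] (IsCharacteristicFunction R χ × PrimitiveRecursive χ)

infixl 7 _×ᵗ_
infixl 6 _+ᵗ_
infix  5 _≐_ _≤ᶠ_
infixr 4 _∧ᶠ_
infixr 3 _∨ᶠ_
infixr 2 _⇒ᶠ_

data Term : Set where
  var     : ℕ → Term
  0ᵗ 1ᵗ   : Term
  _+ᵗ_    : Term → Term → Term
  _×ᵗ_    : Term → Term → Term

data Formula : Set where
  _≐_ _≤ᶠ_         : Term → Term → Formula
  ¬ᶠ_              : Formula → Formula
  _∧ᶠ_ _∨ᶠ_ _⇒ᶠ_   : Formula → Formula → Formula
  ∀ᶠ ∃ᶠ            : ℕ → Formula → Formula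

∀≤ ∃≤ : ℕ → Term → Formula → Formula
∀≤ i t A = ∀ᶠ i (var i ≤ᶠ t ⇒ᶠ A)
∃≤ i t A = ∃ᶠ i (var i ≤ᶠ t ∧ᶠ A)

OccursIn : ℕ → Term → Set
OccursIn i (var j)  = i ≡ j
OccursIn i 0ᵗ       = ⊥
OccursIn i 1ᵗ       = ⊥
OccursIn i (t +ᵗ s) = OccursIn i t ⊎ OccursIn i s
OccursIn i (t ×ᵗ s) = OccursIn i t ⊎ OccursIn i s

data IsΔ₀ : Formula → Set where
  eq  : ∀ t s → IsΔ₀ (t ≐ s)
  leq : ∀ t s → IsΔ₀ (t ≤ᶠ s)
  neg : ∀ {A} → IsΔ₀ A → IsΔ₀ (¬ᶠ A)
  and : ∀ {A B} → IsΔ₀ A → IsΔ₀ B → IsΔ₀ (A ∧ᶠ B)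
  or  : ∀ {A B} → IsΔ₀ A → IsΔ₀ B → IsΔ₀ (A ∨ᶠ B)
  imp : ∀ {A B} → IsΔ₀ A → IsΔ₀ B → IsΔ₀ (A ⇒ᶠ B)
  all : ∀ {i t A} → ¬ OccursIn i t → IsΔ₀ A → IsΔ₀ (∀≤ i t A)
  ex  : ∀ {i t A} → ¬ OccursIn i t → IsΔ₀ A → IsΔ₀ (∃≤ i t A)

_[_↦_] : {X : Set} → (ℕ → X) → ℕ → X → ℕ → X
(f [ i ↦ x ]) j = if does (i ≟ j) then x else f j

substᵗ : (ℕ → Term) → Term → Term
substᵗ σ (var i)  = σ i
substᵗ σ 0ᵗ       = 0ᵗ
substᵗ σ 1ᵗ       = 1ᵗ
substᵗ σ (t +ᵗ s) = substᵗ σ t +ᵗ substᵗ σ s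
substᵗ σ (t ×ᵗ s) = substᵗ σ t ×ᵗ substᵗ σ s

-- Simultaneous substitution for the free occurrences of variables.  Bound
-- variables are not renamed; below it is only used with closed terms, where
-- no capture can happen.
substᶠ : (ℕ → Term) → Formula → Formula
substᶠ σ (t ≐ s)  = substᵗ σ t ≐ substᵗ σ s
substᶠ σ (t ≤ᶠ s) = substᵗ σ t ≤ᶠ substᵗ σ s
substᶠ σ (¬ᶠ A)   = ¬ᶠ substᶠ σ A
substᶠ σ (A ∧ᶠ B) = substᶠ σ A ∧ᶠ substᶠ σ B
substᶠ σ (A ∨ᶠ B) = substᶠ σ A ∨ᶠ substᶠ σ B
substᶠ σ (A ⇒ᶠ B) = substᶠ σ A ⇒ᶠ substᶠ σ B
substᶠ σ (∀ᶠ i A) = ∀ᶠ i (substᶠ (σ [ i ↦ var i ]) A)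
substᶠ σ (∃ᶠ i A) = ∃ᶠ i (substᶠ (σ [ i ↦ var i ]) A)

numeral : ℕ → Term
numeral zero    = 0ᵗ
numeral (suc n) = numeral n +ᵗ 1ᵗ

instantiate : Formula → ℕ → Formula
instantiate θ a = substᶠ (λ _ → numeral a) θ

value : (ℕ → ℕ) → Term → ℕ
value ρ (var i)  = ρ i
value ρ 0ᵗ       = 0
value ρ 1ᵗ       = 1
value ρ (t +ᵗ s) = value ρ t + value ρ s
value ρ (t ×ᵗ s) = value ρ t * value ρ s

-- On Δ₀-formulas this is decidable, so there the constructive reading of the
-- connectives agrees with classical truth.
infix 1 _⊨_
_⊨_ : (ℕ → ℕ) → Formula → Set
ρ ⊨ (t ≐ s)  = value ρ t ≡ value ρ s
ρ ⊨ (t ≤ᶠ s) = value ρ t ≤ value ρ s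
ρ ⊨ (¬ᶠ A)   = ¬ (ρ ⊨ A)
ρ ⊨ (A ∧ᶠ B) = (ρ ⊨ A) × (ρ ⊨ B)
ρ ⊨ (A ∨ᶠ B) = (ρ ⊨ A) ⊎ (ρ ⊨ B)
ρ ⊨ (A ⇒ᶠ B) = (ρ ⊨ A) → (ρ ⊨ B)
ρ ⊨ (∀ᶠ i A) = ∀ (n : ℕ) → ρ [ i ↦ n ] ⊨ A
ρ ⊨ (∃ᶠ i A) = ∃[ n ] (ρ [ i ↦ n ] ⊨ A)

-- For a sentence the assignment is irrelevant.
True : Formula → Set
True A = ∀ (ρ : ℕ → ℕ) → ρ ⊨ A

record GödelCoding : Set where
  field
    code           : Term ⊎ Formula → ℕ
    code-injective : Injective _≡_ _≡_ code

  ⌜_⌝ᵗ : Term → ℕ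
  ⌜ t ⌝ᵗ = code (inj₁ t)

  ⌜_⌝ : Formula → ℕ
  ⌜ A ⌝ = code (inj₂ A)

  field
    var-codes : PrimitiveRecursiveRelation {1} (λ xs → ∃[ i ] (head xs ≡ ⌜ var i ⌝ᵗ))
    var-code  : ∃[ p ] (∀ i → eval p (i ∷ []) ≡ ⌜ var i ⌝ᵗ)
    var-index : ∃[ p ] (∀ i → eval p (⌜ var i ⌝ᵗ ∷ []) ≡ i)

    +-code : ∃[ p ] (∀ t s → eval p (⌜ t ⌝ᵗ ∷ ⌜ s ⌝ᵗ ∷ []) ≡ ⌜ t +ᵗ s ⌝ᵗ)
    ×-code : ∃[ p ] (∀ t s → eval p (⌜ t ⌝ᵗ ∷ ⌜ s ⌝ᵗ ∷ []) ≡ ⌜ t ×ᵗ s ⌝ᵗ)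
    ≐-code : ∃[ p ] (∀ t s → eval p (⌜ t ⌝ᵗ ∷ ⌜ s ⌝ᵗ ∷ []) ≡ ⌜ t ≐ s ⌝)
    ≤-code : ∃[ p ] (∀ t s → eval p (⌜ t ⌝ᵗ ∷ ⌜ s ⌝ᵗ ∷ []) ≡ ⌜ t ≤ᶠ s ⌝)
    ¬-code : ∃[ p ] (∀ A → eval p (⌜ A ⌝ ∷ []) ≡ ⌜ ¬ᶠ A ⌝)
    ∧-code : ∃[ p ] (∀ A B → eval p (⌜ A ⌝ ∷ ⌜ B ⌝ ∷ []) ≡ ⌜ A ∧ᶠ B ⌝)
    ∨-code : ∃[ p ] (∀ A B → eval p (⌜ A ⌝ ∷ ⌜ B ⌝ ∷ []) ≡ ⌜ A ∨ᶠ B ⌝)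
    ⇒-code : ∃[ p ] (∀ A B → eval p (⌜ A ⌝ ∷ ⌜ B ⌝ ∷ []) ≡ ⌜ A ⇒ᶠ B ⌝)
    ∀≤-code : ∃[ p ] (∀ i t A → ¬ OccursIn i t →
                eval p (⌜ var i ⌝ᵗ ∷ ⌜ t ⌝ᵗ ∷ ⌜ A ⌝ ∷ []) ≡ ⌜ ∀≤ i t A ⌝)
    ∃≤-code : ∃[ p ] (∀ i t A → ¬ OccursIn i t →
                eval p (⌜ var i ⌝ᵗ ∷ ⌜ t ⌝ᵗ ∷ ⌜ A ⌝ ∷ []) ≡ ⌜ ∃≤ i t A ⌝)

    +-increasing : ∀ t s → ⌜ t ⌝ᵗ < ⌜ t +ᵗ s ⌝ᵗ × ⌜ s ⌝ᵗ < ⌜ t +ᵗ s ⌝ᵗ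
    ×-increasing : ∀ t s → ⌜ t ⌝ᵗ < ⌜ t ×ᵗ s ⌝ᵗ × ⌜ s ⌝ᵗ < ⌜ t ×ᵗ s ⌝ᵗ
    ≐-increasing : ∀ t s → ⌜ t ⌝ᵗ < ⌜ t ≐ s ⌝ × ⌜ s ⌝ᵗ < ⌜ t ≐ s ⌝
    ≤-increasing : ∀ t s → ⌜ t ⌝ᵗ < ⌜ t ≤ᶠ s ⌝ × ⌜ s ⌝ᵗ < ⌜ t ≤ᶠ s ⌝
    ¬-increasing : ∀ A → ⌜ A ⌝ < ⌜ ¬ᶠ A ⌝
    ∧-increasing : ∀ A B → ⌜ A ⌝ < ⌜ A ∧ᶠ B ⌝ × ⌜ B ⌝ < ⌜ A ∧ᶠ B ⌝
    ∨-increasing : ∀ A B → ⌜ A ⌝ < ⌜ A ∨ᶠ B ⌝ × ⌜ B ⌝ < ⌜ A ∨ᶠ B ⌝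
    ⇒-increasing : ∀ A B → ⌜ A ⌝ < ⌜ A ⇒ᶠ B ⌝ × ⌜ B ⌝ < ⌜ A ⇒ᶠ B ⌝
    ∀≤-increasing : ∀ i t A → ¬ OccursIn i t →
      ⌜ var i ⌝ᵗ < ⌜ ∀≤ i t A ⌝ × ⌜ t ⌝ᵗ < ⌜ ∀≤ i t A ⌝ × ⌜ A ⌝ < ⌜ ∀≤ i t A ⌝
    ∃≤-increasing : ∀ i t A → ¬ OccursIn i t →
      ⌜ var i ⌝ᵗ < ⌜ ∃≤ i t A ⌝ × ⌜ t ⌝ᵗ < ⌜ ∃≤ i t A ⌝ × ⌜ A ⌝ < ⌜ ∃≤ i t A ⌝

SatΔ₀ : GödelCoding → Vec ℕ 2 → Set
SatΔ₀ G (x ∷ a ∷ []) = ∃[ θ ] (IsΔ₀ θ × x ≡ ⌜ θ ⌝ × True (instantiate θ a))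
  where open GödelCoding G

{-# OPTIONS --safe #-}
module Submission where

-- Truth is computed by course-of-values recursion on the code c of a formula, simultaneously
-- for all assignments of values ≤ b to the variables with codes below x.  There are finitely many
-- of these, so the truth values for all smaller codes fit into one number.  The bound b is an
-- iterate of y ↦ y + y + y * y, large enough that no value of a term met while evaluating the
-- formula x at a exceeds it: crossing a bounded quantifier raises the values by a controlled
-- number of iterations and lowers the code.  Constituents of a code are found by bounded
-- search, so no decoding functions are needed.  The clauses define a relation "c is the code of
-- a Δ₀-formula with truth value w under e"; it is sound by injectivity of the coding, and it
-- is complete because every formula within the bound receives some w.

open import Defs

open import Data.Bool using (if_then_else_)
open import Data.Fin using (Fin; zero; suc; _↑ʳ_)
open import Data.Fin.Patterns
open import Data.Nat using (ℕ; zero; suc; _+_; _*_; _∸_; _^_; _≤_; _<_; z≤n; s≤s; s≤s⁻¹; _≟_)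
open import Data.Nat.Properties
open import Data.Nat.DivMod using (_%_; _/_; m%n<n; m≡m%n+[m/n]*n)
open import Data.Nat.Tactic.RingSolver using (solve-∀)
open import Data.Nat.Induction using (Acc; acc; <-wellFounded)
open import Data.Product using (∃-syntax; _×_; _,_; proj₁; proj₂)
open import Data.Sum using (_⊎_; inj₁; inj₂; swap)
open import Data.Vec using (Vec; []; _∷_; head; tail; lookup; tabulate; _++_; drop)
open import Data.Vec.Properties using (tabulate∘lookup)
open import Data.Product.Function.NonDependent.Propositional using (_×-⇔_)
open import Data.Sum.Function.Propositional using (_⊎-⇔_)
open import Function using (_∘_; case_of_; _⇔_; mk⇔; Equivalence)
open import Function.Related.TypeIsomorphisms using (→-cong-⇔; ¬-cong-⇔)
open import Relation.Binary.PropositionalEquality hiding ([_])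
open import Relation.Nullary using (¬_; yes; no; contradiction)
open import Relation.Nullary.Decidable using (dec-true; dec-false)

-- Evaluation under a quantifier changes the assignment, whereas primitive recursion keeps its
-- parameters fixed; this is why the assignment becomes an index of the stored values, next to the
-- code. The second obstacle is that no test for codes of formulas is given, and the code functions
-- are specified on genuine codes only. Truth values are therefore recorded positively: falsity is a
-- recorded 0, never a missing 1, since a missing 1 may also mean that the number is not a code.
-- Each clause asks for recorded values of the constituents, and these certify them as codes.
-- Receiving some value is enough for completeness: a recorded 0 for a true formula would contradict
-- soundness, so uniqueness of the value takes no separate argument.

-- Primitive recursive functions paired with their intended meaning

record Fun (n : ℕ) : Set where
  field
    ⟦_⟧     : Vec ℕ n → ℕ
    prog    : PrimRec n
    correct : ∀ xs → eval prog xs ≡ ⟦_⟧ xs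

open Fun

private variable
  m n : ℕ

-- Only the meaning is exchanged, the derivation is kept: from then on a recursion is presented as
-- ordinary arithmetic, and meanings of composites compute to the expected expressions.
redefine : (f : Vec ℕ n → ℕ) (F : Fun n) → (∀ xs → ⟦ F ⟧ xs ≡ f xs) → Fun n
redefine f F F≗f = record
  { ⟦_⟧ = f ; prog = prog F ; correct = λ xs → trans (correct F xs) (F≗f xs) }

⟦_⟧* : Vec (Fun n) m → Vec ℕ n → Vec ℕ m
⟦ [] ⟧*     xs = []
⟦ F ∷ Fs ⟧* xs = ⟦ F ⟧ xs ∷ ⟦ Fs ⟧* xs

progs : Vec (Fun n) m → Vec (PrimRec n) m
progs []       = []
progs (F ∷ Fs) = prog F ∷ progs Fs

evals-progs : (Fs : Vec (Fun n) m) → ∀ xs → evals (progs Fs) xs ≡ ⟦ Fs ⟧* xs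
evals-progs []       xs = refl
evals-progs (F ∷ Fs) xs = cong₂ _∷_ (correct F xs) (evals-progs Fs xs)

evals-projᵖ : (g : Fin m → Fin n) → ∀ xs →
              evals (tabulate (projᵖ ∘ g)) xs ≡ tabulate (lookup xs ∘ g)
evals-projᵖ {zero}  g xs = refl
evals-projᵖ {suc m} g xs = cong (lookup xs (g zero) ∷_) (evals-projᵖ (g ∘ suc) xs)

evals-id : (xs : Vec ℕ n) → evals (tabulate projᵖ) xs ≡ xs
evals-id xs = trans (evals-projᵖ (λ i → i) xs) (tabulate∘lookup xs)

arg : Fin n → Fun n
arg i = record { ⟦_⟧ = λ xs → lookup xs i ; prog = projᵖ i ; correct = λ _ → refl }

infix 9 _[_] _[_]ᴿ

_[_] : Fun m → Vec (Fun n) m → Fun n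
F [ Gs ] = record
  { ⟦_⟧     = λ xs → ⟦ F ⟧ (⟦ Gs ⟧* xs)
  ; prog    = compᵖ (prog F) (progs Gs)
  ; correct = λ xs → trans (correct F _) (cong ⟦ F ⟧ (evals-progs Gs xs)) }

embed : PrimRec n → Fun n
embed p = record { ⟦_⟧ = eval p ; prog = p ; correct = λ _ → refl }

-- Replaces the first k arguments by the m values of Gs, keeping the remaining n arguments.
graft : ∀ k → Vec (Fun (k + n)) m → Fun (m + n) → Fun (k + n)
graft k Gs F = record
  { ⟦_⟧     = λ xs → ⟦ F ⟧ (⟦ Gs ⟧* xs ++ drop k xs)
  ; prog    = compᵖ (prog F) (progs Gs ++ tabulate (λ i → projᵖ (k ↑ʳ i)))
  ; correct = λ xs → trans (correct F _) (cong ⟦ F ⟧ (begin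
      evals (progs Gs ++ tabulate (λ i → projᵖ (k ↑ʳ i))) xs
        ≡⟨ evals-++ (progs Gs) _ xs ⟩
      evals (progs Gs) xs ++ evals (tabulate (λ i → projᵖ (k ↑ʳ i))) xs
        ≡⟨ cong₂ _++_ (evals-progs Gs xs) (trans (evals-projᵖ (k ↑ʳ_) xs) (tabulate-drop k xs)) ⟩
      ⟦ Gs ⟧* xs ++ drop k xs ∎)) }
  where
  open ≡-Reasoning
  evals-++ : ∀ {l m n} (ps : Vec (PrimRec n) l) (qs : Vec (PrimRec n) m) xs →
             evals (ps ++ qs) xs ≡ evals ps xs ++ evals qs xs
  evals-++ []       qs xs = refl
  evals-++ (p ∷ ps) qs xs = cong (eval p xs ∷_) (evals-++ ps qs xs)
  tabulate-drop : ∀ {n} k (xs : Vec ℕ (k + n)) →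
                  tabulate (λ i → lookup xs (k ↑ʳ i)) ≡ drop k xs
  tabulate-drop zero    xs       = tabulate∘lookup xs
  tabulate-drop (suc k) (x ∷ xs) = tabulate-drop k xs

weaken : Fun n → Fun (suc n)
weaken = graft 1 []

natrec : ℕ → (ℕ → ℕ → ℕ) → ℕ → ℕ
natrec z s zero    = z
natrec z s (suc k) = s k (natrec z s k)

natrecᶠ : Fun n → Fun (2 + n) → Fun (suc n)
natrecᶠ Z S = record
  { ⟦_⟧     = λ ys → natrec (⟦ Z ⟧ (tail ys)) (λ i r → ⟦ S ⟧ (i ∷ r ∷ tail ys)) (head ys)
  ; prog    = recᵖ (prog Z) (prog S)
  ; correct = λ { (k ∷ xs) → steps k xs } }
  where
  steps : ∀ k xs → eval (recᵖ (prog Z) (prog S)) (k ∷ xs) ≡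
                   natrec (⟦ Z ⟧ xs) (λ i r → ⟦ S ⟧ (i ∷ r ∷ xs)) k
  steps zero    xs = correct Z xs
  steps (suc k) xs = trans (correct S _) (cong (λ r → ⟦ S ⟧ (k ∷ r ∷ xs)) (steps k xs))

rec : Fun n → Fun (2 + n) → Fun n → Fun n
rec Z S K = record
  { ⟦_⟧     = λ xs → ⟦ natrecᶠ Z S ⟧ (⟦ K ⟧ xs ∷ xs)
  ; prog    = compᵖ (recᵖ (prog Z) (prog S)) (prog K ∷ tabulate projᵖ)
  ; correct = λ xs → trans (correct (natrecᶠ Z S) (eval (prog K) xs ∷ evals (tabulate projᵖ) xs))
      (cong₂ (λ k ys → ⟦ natrecᶠ Z S ⟧ (k ∷ ys)) (correct K xs) (evals-id xs)) }

sucᶠ : Fun n → Fun n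
sucᶠ F = embed sucᵖ [ F ∷ [] ]

lit : ℕ → Fun n
lit zero    = embed zeroᵖ [ [] ]
lit (suc k) = sucᶠ (lit k)

⟦lit⟧ : ∀ k (xs : Vec ℕ n) → ⟦ lit k ⟧ xs ≡ k
⟦lit⟧ zero    xs = refl
⟦lit⟧ (suc k) xs = cong suc (⟦lit⟧ k xs)

const : ℕ → Fun n
const k = redefine (λ _ → k) (lit k) (⟦lit⟧ k)

infixl 6 _⊕_ _⊖_
infixl 7 _⊗_
infixr 8 _⊛_

_⊕_ _⊗_ _⊖_ _⊛_ : Fun n → Fun n → Fun n
F ⊕ G = redefine (λ xs → ⟦ F ⟧ xs + ⟦ G ⟧ xs) (rec G (sucᶠ (arg 1F)) F) λ xs → steps xs (⟦ F ⟧ xs)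
  where
  steps : ∀ xs k → natrec (⟦ G ⟧ xs) (λ _ r → suc r) k ≡ k + ⟦ G ⟧ xs
  steps xs zero    = refl
  steps xs (suc k) = cong suc (steps xs k)
F ⊗ G = redefine (λ xs → ⟦ F ⟧ xs * ⟦ G ⟧ xs) (rec (const 0) (graft 2 [] G ⊕ arg 1F) F)
  λ xs → steps xs (⟦ F ⟧ xs)
  where
  steps : ∀ xs k → natrec 0 (λ _ r → ⟦ G ⟧ xs + r) k ≡ k * ⟦ G ⟧ xs
  steps xs zero    = refl
  steps xs (suc k) = cong (⟦ G ⟧ xs +_) (steps xs k)
-- The iterated step is the predecessor, a recursion that discards the previous value and returns
-- its counter.
F ⊖ G = redefine (λ xs → ⟦ F ⟧ xs ∸ ⟦ G ⟧ xs) (rec F (rec (const 0) (arg 0F) (arg 1F)) G)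
  λ xs → steps xs (⟦ G ⟧ xs)
  where
  predecessor : ∀ k → natrec 0 (λ i _ → i) k ≡ k ∸ 1
  predecessor zero    = refl
  predecessor (suc k) = refl
  steps : ∀ xs k → natrec (⟦ F ⟧ xs) (λ _ r → natrec 0 (λ i _ → i) r) k ≡ ⟦ F ⟧ xs ∸ k
  steps xs zero    = refl
  steps xs (suc k) = begin
    natrec 0 (λ i _ → i) (back k)  ≡⟨ predecessor (back k) ⟩
    back k ∸ 1              ≡⟨ cong (_∸ 1) (steps xs k) ⟩
    ⟦ F ⟧ xs ∸ k ∸ 1        ≡⟨ ∸-+-assoc (⟦ F ⟧ xs) k 1 ⟩
    ⟦ F ⟧ xs ∸ (k + 1)      ≡⟨ cong (⟦ F ⟧ xs ∸_) (+-comm k 1) ⟩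
    ⟦ F ⟧ xs ∸ suc k        ∎
    where
    open ≡-Reasoning
    back : ℕ → ℕ
    back = natrec (⟦ F ⟧ xs) (λ _ r → natrec 0 (λ i _ → i) r)
F ⊛ G = redefine (λ xs → ⟦ F ⟧ xs ^ ⟦ G ⟧ xs) (rec (const 1) (graft 2 [] F ⊗ arg 1F) G)
  λ xs → steps xs (⟦ G ⟧ xs)
  where
  steps : ∀ xs k → natrec 1 (λ _ r → ⟦ F ⟧ xs * r) k ≡ ⟦ F ⟧ xs ^ k
  steps xs zero    = refl
  steps xs (suc k) = cong (⟦ F ⟧ xs *_) (steps xs k)

∑ : ℕ → (ℕ → ℕ) → ℕ
∑ k f = natrec 0 (λ i s → s + f i) k

sum : Fun n → Fun (suc n) → Fun n
sum K F = redefine (λ xs → ∑ (⟦ K ⟧ xs) (λ i → ⟦ F ⟧ (i ∷ xs)))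
  (rec (const 0) (arg 1F ⊕ graft 2 (arg 0F ∷ []) F) K) (λ _ → refl)

-- Relations decided by primitive recursive functions

infix 4 _DecidedBy_

-- Serves both for values of characteristic functions and for the truth values recorded for
-- formulas, so the arithmetic of the connectives is verified once for both.
_DecidedBy_ : Set → ℕ → Set
P DecidedBy k = (k ≡ 1 × P) ⊎ (k ≡ 0 × ¬ P)

record Rel (n : ℕ) : Set₁ where
  field
    ⟪_⟫     : Vec ℕ n → Set
    χ       : Fun n
    decides : ∀ xs → ⟪_⟫ xs DecidedBy ⟦ χ ⟧ xs

open Rel

module _ {P Q : Set} {j k : ℕ} where

  decided-× : P DecidedBy j → Q DecidedBy k → (P × Q) DecidedBy j * k
  decided-× (inj₁ (refl , p))  (inj₁ (refl , q))  = inj₁ (refl , p , q)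
  decided-× (inj₁ (refl , p))  (inj₂ (refl , ¬q)) = inj₂ (refl , ¬q ∘ proj₂)
  decided-× (inj₂ (refl , ¬p)) _                  = inj₂ (refl , ¬p ∘ proj₁)

  decided-⊎ : P DecidedBy j → Q DecidedBy k → (P ⊎ Q) DecidedBy 1 ∸ (1 ∸ j) * (1 ∸ k)
  decided-⊎ (inj₁ (refl , p))  _                  = inj₁ (refl , inj₁ p)
  decided-⊎ (inj₂ (refl , ¬p)) (inj₁ (refl , q))  = inj₁ (refl , inj₂ q)
  decided-⊎ (inj₂ (refl , ¬p)) (inj₂ (refl , ¬q)) =
    inj₂ (refl , λ { (inj₁ p) → ¬p p ; (inj₂ q) → ¬q q })

  decided-→ : P DecidedBy j → Q DecidedBy k → (P → Q) DecidedBy 1 ∸ j * (1 ∸ k)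
  decided-→ (inj₁ (refl , p))  (inj₁ (refl , q))  = inj₁ (refl , λ _ → q)
  decided-→ (inj₁ (refl , p))  (inj₂ (refl , ¬q)) = inj₂ (refl , λ f → ¬q (f p))
  decided-→ (inj₂ (refl , ¬p)) _                  = inj₁ (refl , λ p → contradiction p ¬p)

module _ {P : Set} {k : ℕ} where

  decided-¬ : P DecidedBy k → (¬ P) DecidedBy 1 ∸ k
  decided-¬ (inj₁ (refl , p))  = inj₂ (refl , λ ¬p → ¬p p)
  decided-¬ (inj₂ (refl , ¬p)) = inj₁ (refl , ¬p)

  decided-⇔ : ∀ {Q : Set} → P ⇔ Q → P DecidedBy k → Q DecidedBy k
  decided-⇔ P⇔Q (inj₁ (k≡1 , p))  = inj₁ (k≡1 , Equivalence.to P⇔Q p)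
  decided-⇔ P⇔Q (inj₂ (k≡0 , ¬p)) = inj₂ (k≡0 , ¬p ∘ Equivalence.from P⇔Q)

  decided<2 : P DecidedBy k → k < 2
  decided<2 (inj₁ (refl , _)) = s≤s (s≤s z≤n)
  decided<2 (inj₂ (refl , _)) = s≤s z≤n

  decided⇒≡1⇔ : P DecidedBy k → (k ≡ 1) ⇔ P
  decided⇒≡1⇔ (inj₁ (refl , p))  = mk⇔ (λ _ → p) (λ _ → refl)
  decided⇒≡1⇔ (inj₂ (refl , ¬p)) = mk⇔ (λ ()) (λ p → contradiction p ¬p)

decided-1 : ∀ {P} → P DecidedBy 1 → P
decided-1 (inj₁ (_ , p)) = p

decided-0 : ∀ {P} → P DecidedBy 0 → ¬ P
decided-0 (inj₂ (_ , ¬p)) = ¬p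

infixr 4 _∩_
infixr 3 _∪_
infix  5 _==_ _≼_

_∩_ _∪_ : Rel n → Rel n → Rel n
R ∩ S = record
  { ⟪_⟫ = λ xs → ⟪ R ⟫ xs × ⟪ S ⟫ xs
  ; χ = χ R ⊗ χ S
  ; decides = λ xs → decided-× (decides R xs) (decides S xs) }
R ∪ S = record
  { ⟪_⟫ = λ xs → ⟪ R ⟫ xs ⊎ ⟪ S ⟫ xs
  ; χ = const 1 ⊖ (const 1 ⊖ χ R) ⊗ (const 1 ⊖ χ S)
  ; decides = λ xs → decided-⊎ (decides R xs) (decides S xs) }

∁ : Rel n → Rel n
∁ R = record
  { ⟪_⟫ = λ xs → ¬ ⟪ R ⟫ xs
  ; χ = const 1 ⊖ χ R
  ; decides = λ xs → decided-¬ (decides R xs) }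

reshape : (R : Rel n) {Q : Vec ℕ n → Set} → (∀ xs → ⟪ R ⟫ xs ⇔ Q xs) → Rel n
reshape R {Q} R⇔Q = record
  { ⟪_⟫ = Q ; χ = χ R ; decides = λ xs → decided-⇔ (R⇔Q xs) (decides R xs) }

_[_]ᴿ : Rel m → Vec (Fun n) m → Rel n
R [ Gs ]ᴿ = record
  { ⟪_⟫ = λ xs → ⟪ R ⟫ (⟦ Gs ⟧* xs)
  ; χ = χ R [ Gs ]
  ; decides = λ xs → decides R (⟦ Gs ⟧* xs) }

graftᴿ : ∀ k → Vec (Fun (k + n)) m → Rel (m + n) → Rel (k + n)
graftᴿ k Gs R = record
  { ⟪_⟫ = λ xs → ⟪ R ⟫ (⟦ Gs ⟧* xs ++ drop k xs)
  ; χ = graft k Gs (χ R)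
  ; decides = λ xs → decides R (⟦ Gs ⟧* xs ++ drop k xs) }

≤-decided : ∀ j k → (j ≤ k) DecidedBy 1 ∸ (j ∸ k)
≤-decided zero    k       = inj₁ (cong (1 ∸_) (0∸n≡0 k) , z≤n)
≤-decided (suc j) zero    = inj₂ (0∸n≡0 j , λ ())
≤-decided (suc j) (suc k) = decided-⇔ (mk⇔ s≤s s≤s⁻¹) (≤-decided j k)

_≼_ _==_ : Fun n → Fun n → Rel n
F ≼ G = record
  { ⟪_⟫ = λ xs → ⟦ F ⟧ xs ≤ ⟦ G ⟧ xs
  ; χ = const 1 ⊖ (F ⊖ G)
  ; decides = λ xs → ≤-decided (⟦ F ⟧ xs) (⟦ G ⟧ xs) }
F == G = reshape (F ≼ G ∩ G ≼ F)
  (λ xs → mk⇔ (λ (p , q) → ≤-antisym p q) (λ p → ≤-reflexive p , ≤-reflexive (sym p)))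

Any All : Fun n → Rel (suc n) → Rel n
Any K R = record
  { ⟪_⟫ = λ xs → ∃[ i ] (i < ⟦ K ⟧ xs × ⟪ R ⟫ (i ∷ xs))
  -- The sum counts the witnesses; complementing twice cuts a positive count down to 1.
  ; χ = const 1 ⊖ (const 1 ⊖ sum K (χ R))
  ; decides = λ xs → search xs (⟦ K ⟧ xs) }
  where
  positive : ∀ {P : Set} s → P → P DecidedBy (1 ∸ (1 ∸ (s + 1)))
  positive s p rewrite +-comm s 1 = inj₁ (cong (1 ∸_) (0∸n≡0 s) , p)
  search : ∀ xs k → (∃[ i ] (i < k × ⟪ R ⟫ (i ∷ xs))) DecidedBy
           1 ∸ (1 ∸ ∑ k (λ i → ⟦ χ R ⟧ (i ∷ xs)))
  search xs zero    = inj₂ (refl , λ ())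
  search xs (suc k) with decides R (k ∷ xs)
  ... | inj₁ (χ≡ , r) rewrite χ≡ = positive (∑ k (λ i → ⟦ χ R ⟧ (i ∷ xs))) (k , ≤-refl , r)
  ... | inj₂ (χ≡ , ¬r) rewrite χ≡ | +-identityʳ (∑ k (λ i → ⟦ χ R ⟧ (i ∷ xs))) =
    decided-⇔ (mk⇔ (λ (i , i<k , r) → i , m<n⇒m<1+n i<k , r) restrict) (search xs k)
    where
    restrict : ∃[ i ] (i < suc k × ⟪ R ⟫ (i ∷ xs)) → ∃[ i ] (i < k × ⟪ R ⟫ (i ∷ xs))
    restrict (i , i<1+k , r) with m<1+n⇒m<n∨m≡n i<1+k
    ... | inj₁ i<k  = i , i<k , r
    ... | inj₂ refl = contradiction r ¬r
All K R = reshape (∁ (Any K (∁ R))) λ xs → mk⇔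
  (λ none i i<k → stable (i ∷ xs) λ ¬r → none (i , i<k , ¬r))
  (λ all (i , i<k , ¬r) → ¬r (all i i<k))
  where
  stable : ∀ xs → ¬ ¬ ⟪ R ⟫ xs → ⟪ R ⟫ xs
  stable xs ¬¬r with decides R xs
  ... | inj₁ (_ , r)  = r
  ... | inj₂ (_ , ¬r) = contradiction ¬r ¬¬r

infix 2 _then_else_

_then_else_ : Rel n → Fun n → Fun n → Fun n
R then F else G = χ R ⊗ F ⊕ (const 1 ⊖ χ R) ⊗ G

module _ (R : Rel n) (F G : Fun n) (xs : Vec ℕ n) where

  then-branch : ⟪ R ⟫ xs → ⟦ R then F else G ⟧ xs ≡ ⟦ F ⟧ xs
  then-branch r with decides R xs
  ... | inj₁ (χ≡ , _)  rewrite χ≡ = trans (+-identityʳ _) (+-identityʳ _)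
  ... | inj₂ (_ , ¬r) = contradiction r ¬r

  else-branch : ¬ ⟪ R ⟫ xs → ⟦ R then F else G ⟧ xs ≡ ⟦ G ⟧ xs
  else-branch ¬r with decides R xs
  ... | inj₁ (_ , r)  = contradiction r ¬r
  ... | inj₂ (χ≡ , _) rewrite χ≡ = +-identityʳ _

-- Finite sequences coded by digits

-- Division with remainder and digits; with divisor 0, or base 0, the values are junk.
quot rem : ℕ → ℕ → ℕ
quot s b = ∑ s (λ k → 1 ∸ (suc k * b ∸ s))
rem s b  = s ∸ quot s b * b

opaque
  digit : ℕ → ℕ → ℕ → ℕ
  digit b i s = rem (quot s (b ^ i)) b

quotᶠ remᶠ : Fun n → Fun n → Fun n
quotᶠ F G = redefine (λ xs → quot (⟦ F ⟧ xs) (⟦ G ⟧ xs))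
  (sum F (χ (sucᶠ (arg 0F) ⊗ weaken G ≼ weaken F))) (λ _ → refl)
remᶠ F G = redefine (λ xs → rem (⟦ F ⟧ xs) (⟦ G ⟧ xs)) (F ⊖ quotᶠ F G ⊗ G) (λ _ → refl)

digitᶠ : Fun n → Fun n → Fun n → Fun n
digitᶠ B I F = redefine (λ xs → digit (⟦ B ⟧ xs) (⟦ I ⟧ xs) (⟦ F ⟧ xs))
  (remᶠ (quotᶠ F (B ⊛ I)) B) (λ xs → unfold (⟦ B ⟧ xs) (⟦ I ⟧ xs) (⟦ F ⟧ xs))
  where
  opaque
    unfolding digit
    unfold : ∀ b i s → rem (quot s (b ^ i)) b ≡ digit b i s
    unfold b i s = refl

∑-ones : ∀ q f → (∀ k → k < q → f k ≡ 1) → ∑ q f ≡ q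
∑-ones zero    f ones = refl
∑-ones (suc q) f ones = trans
  (cong₂ _+_ (∑-ones q f (λ k → ones k ∘ m<n⇒m<1+n)) (ones q ≤-refl)) (+-comm q 1)

∑-indicator : ∀ d q f → (∀ k → k < q → f k ≡ 1) → (∀ k → q ≤ k → f k ≡ 0) → ∑ (d + q) f ≡ q
∑-indicator zero    q f ones zeros = ∑-ones q f ones
∑-indicator (suc d) q f ones zeros = trans
  (cong₂ _+_ (∑-indicator d q f ones zeros) (zeros (d + q) (m≤n+m q d))) (+-identityʳ q)

-- `quot` counts the positive multiples of b up to its argument. For r + q * b with r < b these are
-- the first q, and the summation range reaches them all because b is positive.
quot-unique : ∀ r q b → r < b → quot (r + q * b) b ≡ q
quot-unique r q b@(suc _) r<b = begin
  ∑ s f            ≡⟨ cong (λ t → ∑ t f) (m∸n+n≡m q≤s) ⟨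
  ∑ (s ∸ q + q) f  ≡⟨ ∑-indicator (s ∸ q) q f below above ⟩
  q                ∎
  where
  open ≡-Reasoning
  s = r + q * b
  f : ℕ → ℕ
  f k = 1 ∸ (suc k * b ∸ s)
  q≤s : q ≤ s
  q≤s = ≤-trans (m≤m*n q b) (m≤n+m (q * b) r)
  below : ∀ k → k < q → f k ≡ 1
  below k k<q = cong (1 ∸_) (m≤n⇒m∸n≡0 (≤-trans (*-monoˡ-≤ b k<q) (m≤n+m (q * b) r)))
  above : ∀ k → q ≤ k → f k ≡ 0
  above k q≤k = m≤n⇒m∸n≡0 (m<n⇒0<n∸m (+-mono-<-≤ r<b (*-monoˡ-≤ b q≤k)))

rem-unique : ∀ r q b → r < b → rem (r + q * b) b ≡ r
rem-unique r q b r<b rewrite quot-unique r q b r<b = m+n∸n≡m r (q * b)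

quot-rem : ∀ s b → 0 < b → ∃[ r ] ∃[ q ] (r < b × s ≡ r + q * b)
quot-rem s b@(suc _) _ = s % b , s / b , m%n<n s b , m≡m%n+[m/n]*n s b

opaque
  unfolding digit

  digit< : ∀ b i s → 0 < b → digit b i s < b
  digit< b i s 0<b with quot-rem (quot s (b ^ i)) b 0<b
  ... | r , q , r<b , split =
    subst (λ t → rem t b < b) (sym split) (subst (_< b) (sym (rem-unique r q b r<b)) r<b)

table : ℕ → ℕ → (ℕ → ℕ) → ℕ
table b k f = ∑ k (λ i → f i * b ^ i)

tableᶠ : Fun n → Fun n → Fun (suc n) → Fun n
tableᶠ B K F = redefine (λ xs → table (⟦ B ⟧ xs) (⟦ K ⟧ xs) (λ i → ⟦ F ⟧ (i ∷ xs)))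
  (sum K (F ⊗ weaken B ⊛ arg 0F)) (λ _ → refl)

table< : ∀ b k f → (∀ i → i < k → f i < b) → table b k f < b ^ k
table< b zero    f f<b = s≤s z≤n
table< b (suc k) f f<b = begin-strict
  table b k f + f k * b ^ k  <⟨ +-monoˡ-< (f k * b ^ k) (table< b k f (λ i → f<b i ∘ m<n⇒m<1+n)) ⟩
  suc (f k) * b ^ k          ≤⟨ *-monoˡ-≤ (b ^ k) (f<b k ≤-refl) ⟩
  b * b ^ k                  ∎
  where open ≤-Reasoning

-- There are no carries: the entries below position i sum to less than b ^ i, and those above it
-- contribute multiples of b ^ suc i.
table-split : ∀ b k f → (∀ i → i < k → f i < b) → ∀ i → i < k →
              ∃[ r ] ∃[ q ] (r < b ^ i × table b k f ≡ r + (f i + q * b) * b ^ i)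
table-split b (suc k) f f<b i i<1+k with m<1+n⇒m<n∨m≡n i<1+k
... | inj₂ refl = table b k f , 0 , table< b k f (λ j → f<b j ∘ m<n⇒m<1+n)
                , cong (λ x → table b k f + x * b ^ k) (sym (+-identityʳ (f k)))
... | inj₁ i<k with table-split b k f (λ j → f<b j ∘ m<n⇒m<1+n) i i<k | k ∸ suc i | m∸n+n≡m i<k
...   | r , q , r< , split | d | refl = r , q + f k * b ^ d , r< , (begin
  table b k f + f k * b ^ k                             ≡⟨ cong (_+ f k * b ^ k) split ⟩
  r + (f i + q * b) * b ^ i + f k * b ^ k
    ≡⟨ cong (λ x → r + (f i + q * b) * b ^ i + f k * x) power ⟩
  r + (f i + q * b) * b ^ i + f k * (b ^ d * (b * b ^ i))
    ≡⟨ regroup r (f i) q b (b ^ i) (f k) (b ^ d) ⟩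
  r + (f i + (q + f k * b ^ d) * b) * b ^ i             ∎)
  where
  open ≡-Reasoning
  power : b ^ k ≡ b ^ d * (b * b ^ i)
  power = ^-distribˡ-+-* b d (suc i)
  regroup : ∀ r x q b p y z → r + (x + q * b) * p + y * (z * (b * p)) ≡ r + (x + (q + y * z) * b) * p
  regroup = solve-∀

opaque
  unfolding digit

  digit-table : ∀ b k f → (∀ i → i < k → f i < b) → ∀ i → i < k → digit b i (table b k f) ≡ f i
  digit-table b k f f<b i i<k with table-split b k f f<b i i<k
  ... | r , q , r< , split = begin
    rem (quot (table b k f) (b ^ i)) b
      ≡⟨ cong (λ s → rem (quot s (b ^ i)) b) split ⟩
    rem (quot (r + (f i + q * b) * b ^ i) (b ^ i)) b
      ≡⟨ cong (λ s → rem s b) (quot-unique r (f i + q * b) (b ^ i) r<) ⟩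
    rem (f i + q * b) b
      ≡⟨ rem-unique (f i) q b (f<b i i<k) ⟩
    f i                                                   ∎
    where open ≡-Reasoning

-- Recursion that consults the values at all smaller codes

-- Course-of-values recursion for a relation of (c , e , w) whose clause may consult the
-- relation at (c′ , e′ , w′) for all c′ < c, e′ < E and w′ < W.  The past values form a
-- number T whose c′-th digit lists, for each e′, the bits of the rows w′ ↦ S.
opaque
  bitAt : Fun 6
  bitAt = digitᶠ (const 2) (arg 5F)
    (digitᶠ (const 2 ⊛ arg 1F) (arg 4F) (digitᶠ ((const 2 ⊛ arg 1F) ⊛ arg 0F) (arg 3F) (arg 2F)))

recalled : (E W T c e w : Fun n) → Rel n
recalled E W T c e w = bitAt [ E ∷ W ∷ T ∷ c ∷ e ∷ w ∷ [] ] == const 1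

module CourseOfValues (E W : Fun n) (S : Rel (4 + n)) where

  row : Fun (2 + n)
  row = tableᶠ (const 2 ⊛ graft 2 [] W) (graft 2 [] E)
          (tableᶠ (const 2) (graft 3 [] W) (χ S))

  opaque
    -- Each row becomes the next leading digit. The base exceeds every row because a row has `E`
    -- digits in base 2 ^ `W`.
    history : Fun (suc n)
    history = natrecᶠ (const 0)
      (arg 1F ⊕ row ⊗ ((const 2 ⊛ graft 2 [] W) ⊛ graft 2 [] E) ⊛ arg 0F)

  -- Closes the loop: the argument T of `S` is the history below c, itself built from `S`.
  Recursive : Rel (3 + n)
  Recursive = graftᴿ 3 (arg 0F ∷ arg 1F ∷ arg 2F ∷ graft 2 [] history ∷ []) S

  module _ (xs : Vec ℕ n) where

    private
      e# w# : ℕ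
      e# = ⟦ E ⟧ xs
      w# = ⟦ W ⟧ xs

      bit : ℕ → ℕ → ℕ → ℕ
      bit c e w = ⟦ χ S ⟧ (w ∷ e ∷ c ∷ ⟦ history ⟧ (c ∷ xs) ∷ xs)

      bits : ℕ → ℕ → ℕ
      bits c e = table 2 w# (bit c e)

      rows : ℕ → ℕ
      rows c = table (2 ^ w#) e# (bits c)

      bit< : ∀ c e w → w < w# → bit c e w < 2
      bit< c e w _ = decided<2 (decides S _)

      bits< : ∀ c e → e < e# → bits c e < 2 ^ w#
      bits< c e _ = table< 2 w# (bit c e) (bit< c e)

      rows< : ∀ k c → c < k → rows c < (2 ^ w#) ^ e#
      rows< _ c _ = table< (2 ^ w#) e# (bits c) (bits< c)

      opaque
        unfolding history bitAt

        history-table : ∀ c → ⟦ history ⟧ (c ∷ xs) ≡ table ((2 ^ w#) ^ e#) c rows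
        history-table zero    = refl
        history-table (suc c) = cong (_+ rows c * ((2 ^ w#) ^ e#) ^ c) (history-table c)

        bitAt-history : ∀ {k c e w} → c < k → e < e# → w < w# →
                        ⟦ bitAt ⟧ (e# ∷ w# ∷ ⟦ history ⟧ (k ∷ xs) ∷ c ∷ e ∷ w ∷ []) ≡ bit c e w
        bitAt-history {k} {c} {e} {w} c<k e< w< = begin
          digit 2 w (digit (2 ^ w#) e (digit base c (⟦ history ⟧ (k ∷ xs))))
            ≡⟨ cong (λ t → digit 2 w (digit (2 ^ w#) e (digit base c t))) (history-table k) ⟩
          digit 2 w (digit (2 ^ w#) e (digit base c (table base k rows)))
            ≡⟨ cong (λ t → digit 2 w (digit (2 ^ w#) e t)) (digit-table base k rows (rows< k) c c<k) ⟩
          digit 2 w (digit (2 ^ w#) e (rows c))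
            ≡⟨ cong (digit 2 w) (digit-table (2 ^ w#) e# (bits c) (bits< c) e e<) ⟩
          digit 2 w (bits c e)
            ≡⟨ digit-table 2 w# (bit c e) (bit< c e) w w< ⟩
          bit c e w ∎
          where
          open ≡-Reasoning
          base : ℕ
          base = (2 ^ w#) ^ e#

    -- The interface that hides the encoding: within range, a lookup agrees with the relation
    -- itself, at whatever later stage k the history is taken.
    recall-history : ∀ {k c e w} → c < k → e < e# → w < w# →
                     (⟦ bitAt ⟧ (e# ∷ w# ∷ ⟦ history ⟧ (k ∷ xs) ∷ c ∷ e ∷ w ∷ []) ≡ 1) ⇔
                     ⟪ Recursive ⟫ (w ∷ e ∷ c ∷ xs)
    recall-history c<k e< w< rewrite bitAt-history c<k e< w< = decided⇒≡1⇔ (decides S _)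

-- Semantics of bounded quantifiers and of substituted numerals

update-same : ∀ {X : Set} (ρ : ℕ → X) i x → (ρ [ i ↦ x ]) i ≡ x
update-same ρ i x = cong (λ b → if b then x else ρ i) (dec-true (i ≟ i) refl)

update-other : ∀ {X : Set} (ρ : ℕ → X) i j x → i ≢ j → (ρ [ i ↦ x ]) j ≡ ρ j
update-other ρ i j x i≢j = cong (λ b → if b then x else ρ j) (dec-false (i ≟ j) i≢j)

value-update : ∀ {ρ i} t n → ¬ OccursIn i t → value (ρ [ i ↦ n ]) t ≡ value ρ t
value-update {ρ} {i} (var j) n i∉t = update-other ρ i j n i∉t
value-update 0ᵗ       n i∉t = refl
value-update 1ᵗ       n i∉t = refl
value-update (t +ᵗ s) n i∉t = cong₂ _+_ (value-update t n (i∉t ∘ inj₁)) (value-update s n (i∉t ∘ inj₂))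
value-update (t ×ᵗ s) n i∉t = cong₂ _*_ (value-update t n (i∉t ∘ inj₁)) (value-update s n (i∉t ∘ inj₂))

module _ {ρ : ℕ → ℕ} {i : ℕ} {t : Term} (A : Formula) (i∉t : ¬ OccursIn i t) where

  -- As i does not occur in t, giving i a new value leaves the bound unchanged.
  guard : ∀ n → (n ≤ value ρ t) ⇔ (ρ [ i ↦ n ] ⊨ var i ≤ᶠ t)
  guard n = mk⇔ (subst₂ _≤_ (sym (update-same ρ i n)) (sym (value-update t n i∉t)))
                (subst₂ _≤_ (update-same ρ i n) (value-update t n i∉t))

  ⊨-∀≤ : (∀ n → n ≤ value ρ t → ρ [ i ↦ n ] ⊨ A) ⇔ (ρ ⊨ ∀≤ i t A)
  ⊨-∀≤ = mk⇔ (λ all n → all n ∘ Equivalence.from (guard n))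
             (λ all n → all n ∘ Equivalence.to (guard n))

  ⊨-∃≤ : (∃[ n ] (n ≤ value ρ t × (ρ [ i ↦ n ] ⊨ A))) ⇔ (ρ ⊨ ∃≤ i t A)
  ⊨-∃≤ = mk⇔ (λ (n , n≤ , p) → n , Equivalence.to (guard n) n≤ , p)
             (λ (n , n≤ , p) → n , Equivalence.from (guard n) n≤ , p)

value-numeral : ∀ ρ a → value ρ (numeral a) ≡ a
value-numeral ρ zero    = refl
value-numeral ρ (suc a) = trans (cong (_+ 1) (value-numeral ρ a)) (+-comm a 1)

module Instantiation (a : ℕ) where

  -- σ substitutes the numeral of a for the free variables and fixes the variables that have
  -- become bound; ρ′ is the assignment that the substituted formula sees under ρ.
  Follows : (ℕ → Term) → (ℕ → ℕ) → (ℕ → ℕ) → Set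
  Follows σ ρ ρ′ = ∀ j → (σ j ≡ numeral a × ρ′ j ≡ a) ⊎ (σ j ≡ var j × ρ′ j ≡ ρ j)

  Follows-update : ∀ {σ ρ ρ′} i n → Follows σ ρ ρ′ →
                   Follows (σ [ i ↦ var i ]) (ρ [ i ↦ n ]) (ρ′ [ i ↦ n ])
  Follows-update {σ} {ρ} {ρ′} i n follows j with i ≟ j | follows j
  ... | yes refl | _ =
    inj₂ (update-same σ i (var i) , trans (update-same ρ′ i n) (sym (update-same ρ i n)))
  ... | no i≢j | inj₁ (σj≡ , ρ′j≡) =
    inj₁ (trans (update-other σ i j _ i≢j) σj≡ , trans (update-other ρ′ i j n i≢j) ρ′j≡)
  ... | no i≢j | inj₂ (σj≡ , ρ′j≡) =
    inj₂ (trans (update-other σ i j _ i≢j) σj≡ ,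
          trans (update-other ρ′ i j n i≢j) (trans ρ′j≡ (sym (update-other ρ i j n i≢j))))

  value-subst : ∀ {σ ρ ρ′} → Follows σ ρ ρ′ → ∀ t → value ρ (substᵗ σ t) ≡ value ρ′ t
  value-subst {ρ = ρ} follows (var j) with follows j
  ... | inj₁ (σj≡ , ρ′j≡) = trans (cong (value ρ) σj≡) (trans (value-numeral ρ a) (sym ρ′j≡))
  ... | inj₂ (σj≡ , ρ′j≡) = trans (cong (value ρ) σj≡) (sym ρ′j≡)
  value-subst follows 0ᵗ       = refl
  value-subst follows 1ᵗ       = refl
  value-subst follows (t +ᵗ s) = cong₂ _+_ (value-subst follows t) (value-subst follows s)
  value-subst follows (t ×ᵗ s) = cong₂ _*_ (value-subst follows t) (value-subst follows s)

  ⊨-subst : ∀ {σ ρ ρ′} → Follows σ ρ ρ′ → ∀ A → (ρ ⊨ substᶠ σ A) ⇔ (ρ′ ⊨ A)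
  ⊨-subst follows (t ≐ s) = mk⇔ (subst₂ _≡_ (value-subst follows t) (value-subst follows s))
                                (subst₂ _≡_ (sym (value-subst follows t)) (sym (value-subst follows s)))
  ⊨-subst follows (t ≤ᶠ s) = mk⇔ (subst₂ _≤_ (value-subst follows t) (value-subst follows s))
                                 (subst₂ _≤_ (sym (value-subst follows t)) (sym (value-subst follows s)))
  ⊨-subst follows (¬ᶠ A)   = ¬-cong-⇔ (⊨-subst follows A)
  ⊨-subst follows (A ∧ᶠ B) = ⊨-subst follows A ×-⇔ ⊨-subst follows B
  ⊨-subst follows (A ∨ᶠ B) = ⊨-subst follows A ⊎-⇔ ⊨-subst follows B
  ⊨-subst follows (A ⇒ᶠ B) = →-cong-⇔ (⊨-subst follows A) (⊨-subst follows B)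
  ⊨-subst follows (∀ᶠ i A) = mk⇔
    (λ all n → Equivalence.to   (⊨-subst (Follows-update i n follows) A) (all n))
    (λ all n → Equivalence.from (⊨-subst (Follows-update i n follows) A) (all n))
  ⊨-subst follows (∃ᶠ i A) = mk⇔
    (λ (n , p) → n , Equivalence.to   (⊨-subst (Follows-update i n follows) A) p)
    (λ (n , p) → n , Equivalence.from (⊨-subst (Follows-update i n follows) A) p)

  True-instantiate : ∀ θ → ((λ _ → a) ⊨ θ) ⇔ True (instantiate θ a)
  True-instantiate θ = mk⇔
    (λ p ρ → Equivalence.from (⊨-subst (λ _ → inj₁ (refl , refl)) θ) p)
    (λ true → Equivalence.to (⊨-subst (λ _ → inj₁ (refl , refl)) θ) (true (λ _ → 0)))

-- Recursion over codes of terms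

module Codes (G : GödelCoding) where
  open GödelCoding G

  IsVar : Rel 1
  IsVar = record
    { ⟪_⟫ = λ xs → ∃[ i ] (head xs ≡ ⌜ var i ⌝ᵗ)
    ; χ = record { ⟦_⟧ = proj₁ var-codes
                 ; prog = proj₁ (proj₂ (proj₂ var-codes))
                 ; correct = proj₂ (proj₂ (proj₂ var-codes)) }
    ; decides = λ xs → decision (proj₁ (proj₂ var-codes) xs) }
    where
    decision : ∀ {P : Set} {k} → (k ≡ 0 ⊎ k ≡ 1) × (k ≡ 1 ⇔ P) → P DecidedBy k
    decision (inj₂ k≡1 , ≡1⇔P) = inj₁ (k≡1 , Equivalence.to ≡1⇔P k≡1)
    decision (inj₁ refl , ≡1⇔P) = inj₂ (refl , λ p → contradiction (Equivalence.from ≡1⇔P p) λ ())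

  ⌜⌝ᵗ-injective : ∀ {t s} → ⌜ t ⌝ᵗ ≡ ⌜ s ⌝ᵗ → t ≡ s
  ⌜⌝ᵗ-injective p with refl ← code-injective p = refl

  ⌜⌝-injective : ∀ {A B} → ⌜ A ⌝ ≡ ⌜ B ⌝ → A ≡ B
  ⌜⌝-injective p with refl ← code-injective p = refl

  -- Instantiated for term values and for the test that a variable does not occur. Terms bind
  -- nothing, so the assignment index has the single value 0. Results of subterms are searched for
  -- below `W`.
  module TermFold (W : Fun n) (Var : Fun (suc n)) (zero# one# : ℕ) (Add Mul : Fun 2) where

    clause : Rel (4 + n)
    clause =
        IsVar [ arg 2F ∷ [] ]ᴿ ∩ arg 0F == graft 4 (arg 2F ∷ []) Var
      ∪ arg 2F == const ⌜ 0ᵗ ⌝ᵗ ∩ arg 0F == const zero#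
      ∪ arg 2F == const ⌜ 1ᵗ ⌝ᵗ ∩ arg 0F == const one#
      ∪ Any (arg 2F) (Any (arg 3F) (Any (graft 6 [] W) (Any (graft 7 [] W)
          ( recalled (const 1) (graft 8 [] W) (arg 7F) (arg 3F) (const 0) (arg 1F)
          ∩ recalled (const 1) (graft 8 [] W) (arg 7F) (arg 2F) (const 0) (arg 0F)
          ∩ ( arg 6F == embed (proj₁ +-code) [ arg 3F ∷ arg 2F ∷ [] ]
              ∩ arg 4F == Add [ arg 1F ∷ arg 0F ∷ [] ]
            ∪ arg 6F == embed (proj₁ ×-code) [ arg 3F ∷ arg 2F ∷ [] ]
              ∩ arg 4F == Mul [ arg 1F ∷ arg 0F ∷ [] ])))))

    open CourseOfValues (const 1) W clause

    Graph : Rel (2 + n)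
    Graph = graftᴿ 2 (arg 0F ∷ const 0 ∷ arg 1F ∷ []) Recursive

    module _ (xs : Vec ℕ n) where

      fold : Term → ℕ
      fold (var i)  = ⟦ Var ⟧ (⌜ var i ⌝ᵗ ∷ xs)
      fold 0ᵗ       = zero#
      fold 1ᵗ       = one#
      fold (t +ᵗ s) = ⟦ Add ⟧ (fold t ∷ fold s ∷ [])
      fold (t ×ᵗ s) = ⟦ Mul ⟧ (fold t ∷ fold s ∷ [])

      private
        Composite : ℕ → ℕ → ℕ → ℕ → ℕ → ℕ → Set
        Composite c w y z u v =
          (c ≡ eval (proj₁ +-code) (y ∷ z ∷ []) × w ≡ ⟦ Add ⟧ (u ∷ v ∷ [])) ⊎
          (c ≡ eval (proj₁ ×-code) (y ∷ z ∷ []) × w ≡ ⟦ Mul ⟧ (u ∷ v ∷ []))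

        Composite-sound : ∀ {c w y z u v} →
          ∃[ t ] (y ≡ ⌜ t ⌝ᵗ × u ≡ fold t) → ∃[ t ] (z ≡ ⌜ t ⌝ᵗ × v ≡ fold t) →
          Composite c w y z u v → ∃[ t ] (c ≡ ⌜ t ⌝ᵗ × w ≡ fold t)
        Composite-sound (t , refl , refl) (s , refl , refl) (inj₁ (c≡ , w≡)) =
          t +ᵗ s , trans c≡ (proj₂ +-code t s) , w≡
        Composite-sound (t , refl , refl) (s , refl , refl) (inj₂ (c≡ , w≡)) =
          t ×ᵗ s , trans c≡ (proj₂ ×-code t s) , w≡

      -- Induction on c takes the place of decoding: the numbers y and z found by search are codes
      -- by induction, so the specification of the code functions applies to them.
      Graph-sound : ∀ {c w} → Acc _<_ c → ⟪ Graph ⟫ (w ∷ c ∷ xs) → ∃[ t ] (c ≡ ⌜ t ⌝ᵗ × w ≡ fold t)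
      Graph-sound _ (inj₁ ((i , c≡) , w≡)) =
        var i , c≡ , trans w≡ (cong (λ c → ⟦ Var ⟧ (c ∷ xs)) c≡)
      Graph-sound _ (inj₂ (inj₁ (c≡ , w≡))) = 0ᵗ , c≡ , w≡
      Graph-sound _ (inj₂ (inj₂ (inj₁ (c≡ , w≡)))) = 1ᵗ , c≡ , w≡
      Graph-sound (acc smaller)
        (inj₂ (inj₂ (inj₂ (y , y< , z , z< , u , u< , v , v< , yu , zv , op)))) =
        Composite-sound
          (Graph-sound (smaller y<) (Equivalence.to (recall-history xs y< (s≤s z≤n) u<) yu))
          (Graph-sound (smaller z<) (Equivalence.to (recall-history xs z< (s≤s z≤n) v<) zv)) op

      private
        Graph-composite : ∀ {c w} t s → ⌜ t ⌝ᵗ < c → ⌜ s ⌝ᵗ < c →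
          fold t < ⟦ W ⟧ xs → fold s < ⟦ W ⟧ xs →
          ⟪ Graph ⟫ (fold t ∷ ⌜ t ⌝ᵗ ∷ xs) → ⟪ Graph ⟫ (fold s ∷ ⌜ s ⌝ᵗ ∷ xs) →
          Composite c w ⌜ t ⌝ᵗ ⌜ s ⌝ᵗ (fold t) (fold s) → ⟪ Graph ⟫ (w ∷ c ∷ xs)
        Graph-composite t s t<c s<c ft< fs< gt gs op = inj₂ (inj₂ (inj₂
          ( ⌜ t ⌝ᵗ , t<c , ⌜ s ⌝ᵗ , s<c , fold t , ft< , fold s , fs<
          , Equivalence.from (recall-history xs t<c (s≤s z≤n) ft<) gt
          , Equivalence.from (recall-history xs s<c (s≤s z≤n) fs<) gs , op)))

      -- Asking for the bound at all terms with codes up to that of t makes it pass to subterms by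
      -- monotonicity of codes, without a subterm relation.
      Graph-complete : ∀ t → (∀ s → ⌜ s ⌝ᵗ ≤ ⌜ t ⌝ᵗ → fold s < ⟦ W ⟧ xs) →
                       ⟪ Graph ⟫ (fold t ∷ ⌜ t ⌝ᵗ ∷ xs)
      Graph-complete (var i) _ = inj₁ ((i , refl) , refl)
      Graph-complete 0ᵗ _ = inj₂ (inj₁ (refl , refl))
      Graph-complete 1ᵗ _ = inj₂ (inj₂ (inj₁ (refl , refl)))
      Graph-complete (t +ᵗ s) bounded = Graph-composite t s t< s<
        (bounded t (<⇒≤ t<)) (bounded s (<⇒≤ s<))
        (Graph-complete t λ r r≤ → bounded r (≤-trans r≤ (<⇒≤ t<)))
        (Graph-complete s λ r r≤ → bounded r (≤-trans r≤ (<⇒≤ s<)))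
        (inj₁ (sym (proj₂ +-code t s) , refl))
        where
        t< : ⌜ t ⌝ᵗ < ⌜ t +ᵗ s ⌝ᵗ
        t< = proj₁ (+-increasing t s)
        s< : ⌜ s ⌝ᵗ < ⌜ t +ᵗ s ⌝ᵗ
        s< = proj₂ (+-increasing t s)
      Graph-complete (t ×ᵗ s) bounded = Graph-composite t s t< s<
        (bounded t (<⇒≤ t<)) (bounded s (<⇒≤ s<))
        (Graph-complete t λ r r≤ → bounded r (≤-trans r≤ (<⇒≤ t<)))
        (Graph-complete s λ r r≤ → bounded r (≤-trans r≤ (<⇒≤ s<)))
        (inj₂ (sym (proj₂ ×-code t s) , refl))
        where
        t< : ⌜ t ⌝ᵗ < ⌜ t ×ᵗ s ⌝ᵗ
        t< = proj₁ (×-increasing t s)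
        s< : ⌜ s ⌝ᵗ < ⌜ t ×ᵗ s ⌝ᵗ
        s< = proj₂ (×-increasing t s)

-- Growth of values, and assignments coded as numbers

opaque
  -- One iteration dominates both y + y and y * y, hence absorbs either term operation. The start
  -- suc a bounds the assigned number a and the constant 1.
  level : Fun 2
  level = rec (sucᶠ (arg 1F)) ((arg 1F ⊕ arg 1F) ⊕ arg 1F ⊗ arg 1F) (arg 0F)

opaque
  unfolding level

  level-zero : ∀ a → ⟦ level ⟧ (0 ∷ a ∷ []) ≡ suc a
  level-zero a = refl

  level-suc : ∀ m a → let l = ⟦ level ⟧ (m ∷ a ∷ []) in ⟦ level ⟧ (suc m ∷ a ∷ []) ≡ l + l + l * l
  level-suc m a = refl

level-≤-suc : ∀ m a → ⟦ level ⟧ (m ∷ a ∷ []) ≤ ⟦ level ⟧ (suc m ∷ a ∷ [])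
level-≤-suc m a rewrite level-suc m a = ≤-trans (m≤m+n _ _) (m≤m+n _ _)

level-+ : ∀ m a → let l = ⟦ level ⟧ (m ∷ a ∷ []) in l + l ≤ ⟦ level ⟧ (suc m ∷ a ∷ [])
level-+ m a rewrite level-suc m a = m≤m+n _ _

level-* : ∀ m a → let l = ⟦ level ⟧ (m ∷ a ∷ []) in l * l ≤ ⟦ level ⟧ (suc m ∷ a ∷ [])
level-* m a rewrite level-suc m a = m≤n+m _ _

level-mono : ∀ {m k} a → m ≤ k → ⟦ level ⟧ (m ∷ a ∷ []) ≤ ⟦ level ⟧ (k ∷ a ∷ [])
level-mono {m} {k} a m≤k =
  subst (λ k → ⟦ level ⟧ (m ∷ a ∷ []) ≤ ⟦ level ⟧ (k ∷ a ∷ [])) (m∸n+n≡m m≤k) (go (k ∸ m))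
  where
  go : ∀ d → ⟦ level ⟧ (m ∷ a ∷ []) ≤ ⟦ level ⟧ (d + m ∷ a ∷ [])
  go zero    = ≤-refl
  go (suc d) = ≤-trans (go d) (level-≤-suc (d + m) a)

level-positive : ∀ m a → suc a ≤ ⟦ level ⟧ (m ∷ a ∷ [])
level-positive m a = subst (_≤ ⟦ level ⟧ (m ∷ a ∷ [])) (level-zero a) (level-mono a z≤n)

-- Assignments of values below b to the variables with codes below x are the base-b numerals of
-- length x; the digit at position ⌜ var i ⌝ᵗ is the value of var i.
override-entry : Fun 6
override-entry = arg 0F == arg 4F then arg 5F else digitᶠ (arg 1F) (arg 0F) (arg 3F)

opaque
  override : Fun 5
  override = tableᶠ (arg 0F) (arg 1F) override-entry

module _ {b x e y n : ℕ} (n<b : n < b) where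

  private
    0<b : 0 < b
    0<b = ≤-trans (s≤s z≤n) n<b

    entry : ℕ → ℕ
    entry j = ⟦ override-entry ⟧ (j ∷ b ∷ x ∷ e ∷ y ∷ n ∷ [])

    entry-≡ : entry y ≡ n
    entry-≡ = then-branch (arg 0F == arg 4F) (arg 5F) (digitᶠ (arg 1F) (arg 0F) (arg 3F))
                (y ∷ b ∷ x ∷ e ∷ y ∷ n ∷ []) refl

    entry-≢ : ∀ {j} → j ≢ y → entry j ≡ digit b j e
    entry-≢ {j} = else-branch (arg 0F == arg 4F) (arg 5F) (digitᶠ (arg 1F) (arg 0F) (arg 3F))
                    (j ∷ b ∷ x ∷ e ∷ y ∷ n ∷ [])

    entry< : ∀ j → j < x → entry j < b
    entry< j _ with j ≟ y
    ... | yes refl = subst (_< b) (sym entry-≡) n<b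
    ... | no j≢y   = subst (_< b) (sym (entry-≢ j≢y)) (digit< b j e 0<b)

  opaque
    unfolding override

    override< : ⟦ override ⟧ (b ∷ x ∷ e ∷ y ∷ n ∷ []) < b ^ x
    override< = table< b x entry entry<

    digit-override-same : y < x → digit b y (⟦ override ⟧ (b ∷ x ∷ e ∷ y ∷ n ∷ [])) ≡ n
    digit-override-same y<x = trans (digit-table b x entry entry< y y<x) entry-≡

    digit-override-other : ∀ {j} → j < x → j ≢ y →
      digit b j (⟦ override ⟧ (b ∷ x ∷ e ∷ y ∷ n ∷ [])) ≡ digit b j e
    digit-override-other j<x j≢y = trans (digit-table b x entry entry< _ j<x) (entry-≢ j≢y)

var-injective : ∀ {i j} → Term.var i ≡ var j → i ≡ j
var-injective refl = refl

*<2 : ∀ {j k} → j < 2 → k < 2 → j * k < 2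
*<2 j<2 k<2 = s≤s (*-mono-≤ (s≤s⁻¹ j<2) (s≤s⁻¹ k<2))

1∸<2 : ∀ k → 1 ∸ k < 2
1∸<2 k = s≤s (m∸n≤m 1 k)

-- Picks the clause for a bounded quantifier once every instance has a recorded value.
every-or-some : ∀ {P Q : ℕ → Set} k → (∀ n → n < k → P n ⊎ Q n) →
                (∀ n → n < k → P n) ⊎ (∃[ n ] (n < k × Q n))
every-or-some zero    P⊎Q = inj₁ λ _ ()
every-or-some {P} {Q} (suc k) P⊎Q = extend (every-or-some k λ n → P⊎Q n ∘ m<n⇒m<1+n) (P⊎Q k ≤-refl)
  where
  extend : (∀ n → n < k → P n) ⊎ (∃[ n ] (n < k × Q n)) → P k ⊎ Q k →
           (∀ n → n < suc k → P n) ⊎ (∃[ n ] (n < suc k × Q n))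
  extend (inj₂ (n , n<k , q)) _        = inj₂ (n , m<n⇒m<1+n n<k , q)
  extend (inj₁ _)             (inj₂ q) = inj₂ (k , ≤-refl , q)
  extend (inj₁ every)         (inj₁ p) = inj₁ λ n n<1+k → case m<1+n⇒m<n∨m≡n n<1+k of λ where
    (inj₁ n<k)  → every n n<k
    (inj₂ refl) → p

-- The truth relation for bounded formulas

module Evaluation (G : GödelCoding) where
  open GödelCoding G
  open Codes G

  opaque
    -- Values reach at most iterate x * x; the successor makes them digits in this base.
    base : Fun 2
    base = sucᶠ (level [ arg 0F ⊗ arg 0F ∷ arg 1F ∷ [] ])

  opaque
    unfolding base

    ⟦base⟧ : ∀ x a → ⟦ base ⟧ (x ∷ a ∷ []) ≡ suc (⟦ level ⟧ (x * x ∷ a ∷ []))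
    ⟦base⟧ x a = refl

  module Value = TermFold (graft 1 [] base) (digitᶠ (graft 2 [] base) (arg 0F) (arg 1F))
                          0 1 (arg 0F ⊕ arg 1F) (arg 0F ⊗ arg 1F)

  -- The product over all variables of a term of 1 or, at the variable with the given code, 0.
  module NonOccurrence = TermFold {n = 1} (const 2) (χ (∁ (arg 0F == arg 1F)))
                          1 1 (arg 0F ⊗ arg 1F) (arg 0F ⊗ arg 1F)

  module _ (i : ℕ) where

    private
      mark : Term → ℕ
      mark = NonOccurrence.fold (⌜ var i ⌝ᵗ ∷ [])

      mark-var : ∀ j → (¬ (⌜ var j ⌝ᵗ ≡ ⌜ var i ⌝ᵗ)) DecidedBy mark (var j)
      mark-var j = decides (∁ (arg 0F == arg 1F)) (⌜ var j ⌝ᵗ ∷ ⌜ var i ⌝ᵗ ∷ [])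

    absent⇒∉ : ∀ t → mark t ≡ 1 → ¬ OccursIn i t
    absent⇒∉ (var j)  p refl     = Equivalence.to (decided⇒≡1⇔ (mark-var j)) p refl
    absent⇒∉ (t +ᵗ s) p (inj₁ o) = absent⇒∉ t (m*n≡1⇒m≡1 (mark t) (mark s) p) o
    absent⇒∉ (t +ᵗ s) p (inj₂ o) = absent⇒∉ s (m*n≡1⇒n≡1 (mark t) (mark s) p) o
    absent⇒∉ (t ×ᵗ s) p (inj₁ o) = absent⇒∉ t (m*n≡1⇒m≡1 (mark t) (mark s) p) o
    absent⇒∉ (t ×ᵗ s) p (inj₂ o) = absent⇒∉ s (m*n≡1⇒n≡1 (mark t) (mark s) p) o

    ∉⇒absent : ∀ t → ¬ OccursIn i t → mark t ≡ 1
    ∉⇒absent (var j)  i∉ = Equivalence.from (decided⇒≡1⇔ (mark-var j))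
      λ codes≡ → i∉ (var-injective (⌜⌝ᵗ-injective (sym codes≡)))
    ∉⇒absent 0ᵗ       i∉ = refl
    ∉⇒absent 1ᵗ       i∉ = refl
    ∉⇒absent (t +ᵗ s) i∉ = cong₂ _*_ (∉⇒absent t (i∉ ∘ inj₁)) (∉⇒absent s (i∉ ∘ inj₂))
    ∉⇒absent (t ×ᵗ s) i∉ = cong₂ _*_ (∉⇒absent t (i∉ ∘ inj₁)) (∉⇒absent s (i∉ ∘ inj₂))

    mark<2 : ∀ t → mark t < 2
    mark<2 (var j)  = decided<2 (mark-var j)
    mark<2 0ᵗ       = s≤s (s≤s z≤n)
    mark<2 1ᵗ       = s≤s (s≤s z≤n)
    mark<2 (t +ᵗ s) = *<2 (mark<2 t) (mark<2 s)
    mark<2 (t ×ᵗ s) = *<2 (mark<2 t) (mark<2 s)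

  -- The clauses below are relations of w ∷ e ∷ c ∷ T ∷ x ∷ a ∷ [], where w is a truth value, e an
  -- assignment, c a code and T the history below c; each bounded quantifier prepends a variable.
  E : Fun 2
  E = base ⊛ arg 0F

  atomic : Rel 6
  atomic = Any (arg 2F) (Any (arg 3F) (Any (graft 6 [] base) (Any (graft 7 [] base)
    ( Value.Graph [ arg 1F ∷ arg 3F ∷ arg 5F ∷ arg 8F ∷ arg 9F ∷ [] ]ᴿ
    ∩ Value.Graph [ arg 0F ∷ arg 2F ∷ arg 5F ∷ arg 8F ∷ arg 9F ∷ [] ]ᴿ
    ∩ ( arg 6F == embed (proj₁ ≐-code) [ arg 3F ∷ arg 2F ∷ [] ] ∩ arg 4F == χ (arg 1F == arg 0F)
      ∪ arg 6F == embed (proj₁ ≤-code) [ arg 3F ∷ arg 2F ∷ [] ] ∩ arg 4F == χ (arg 1F ≼ arg 0F))))))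

  negation : Rel 6
  negation = Any (arg 2F) (Any (const 2)
    ( recalled (graft 6 [] E) (const 2) (arg 5F) (arg 1F) (arg 3F) (arg 0F)
    ∩ arg 4F == embed (proj₁ ¬-code) [ arg 1F ∷ [] ]
    ∩ arg 2F == const 1 ⊖ arg 0F))

  binary : Rel 6
  binary = Any (arg 2F) (Any (arg 3F) (Any (const 2) (Any (const 2)
    -- Both values are looked up even where one settles the connective, since they certify that both
    -- constituents are codes.
    ( recalled (graft 8 [] E) (const 2) (arg 7F) (arg 3F) (arg 5F) (arg 1F)
    ∩ recalled (graft 8 [] E) (const 2) (arg 7F) (arg 2F) (arg 5F) (arg 0F)
    ∩ ( arg 6F == embed (proj₁ ∧-code) [ arg 3F ∷ arg 2F ∷ [] ]
        ∩ arg 4F == arg 1F ⊗ arg 0F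
      ∪ arg 6F == embed (proj₁ ∨-code) [ arg 3F ∷ arg 2F ∷ [] ]
        ∩ arg 4F == const 1 ⊖ (const 1 ⊖ arg 1F) ⊗ (const 1 ⊖ arg 0F)
      ∪ arg 6F == embed (proj₁ ⇒-code) [ arg 3F ∷ arg 2F ∷ [] ]
        ∩ arg 4F == const 1 ⊖ arg 1F ⊗ (const 1 ⊖ arg 0F))))))

  instance-is : ℕ → Rel 11
  instance-is k = recalled (graft 9 [] E) (const 2) (arg 8F) (arg 2F)
    (override [ graft 9 [] base ∷ arg 9F ∷ arg 6F ∷ arg 4F ∷ arg 0F ∷ [] ]) (const k)

  quantified : Rel 6
  quantified = Any (arg 2F) (Any (arg 3F) (Any (arg 4F) (Any (graft 7 [] base)
    -- Here y and z are certified as codes of a variable and a term; q is certified by the recorded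
    -- values of its instances.
    ( IsVar [ arg 3F ∷ [] ]ᴿ
    ∩ NonOccurrence.Graph [ const 1 ∷ arg 2F ∷ arg 3F ∷ [] ]ᴿ
    ∩ Value.Graph [ arg 0F ∷ arg 2F ∷ arg 5F ∷ arg 8F ∷ arg 9F ∷ [] ]ᴿ
    ∩ ( arg 6F == embed (proj₁ ∀≤-code) [ arg 3F ∷ arg 2F ∷ arg 1F ∷ [] ]
        ∩ ( arg 4F == const 1 ∩ All (sucᶠ (arg 0F)) (instance-is 1)
          ∪ arg 4F == const 0 ∩ Any (sucᶠ (arg 0F)) (instance-is 0))
      ∪ arg 6F == embed (proj₁ ∃≤-code) [ arg 3F ∷ arg 2F ∷ arg 1F ∷ [] ]
        ∩ ( arg 4F == const 1 ∩ Any (sucᶠ (arg 0F)) (instance-is 1)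
          ∪ arg 4F == const 0 ∩ All (sucᶠ (arg 0F)) (instance-is 0)))))))

  open CourseOfValues E (const 2) (atomic ∪ negation ∪ binary ∪ quantified) public
    renaming (Recursive to Truth)

  -- Soundness of the truth relation

  module Correctness (x a : ℕ) where

    xs : Vec ℕ 2
    xs = x ∷ a ∷ []

    b : ℕ
    b = ⟦ base ⟧ xs

    _[_≔_]ᵉ : ℕ → ℕ → ℕ → ℕ
    e [ y ≔ n ]ᵉ = ⟦ override ⟧ (b ∷ x ∷ e ∷ y ∷ n ∷ [])

    -- Variables with codes from x on are left free; they cannot occur in a formula with code at
    -- most x.
    Represents : ℕ → (ℕ → ℕ) → Set
    Represents e ρ = ∀ i → ⌜ var i ⌝ᵗ < x → ρ i ≡ digit b ⌜ var i ⌝ᵗ e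

    Represents-update : ∀ {e ρ i n} → ⌜ var i ⌝ᵗ < x → n < b → Represents e ρ →
                        Represents (e [ ⌜ var i ⌝ᵗ ≔ n ]ᵉ) (ρ [ i ↦ n ])
    Represents-update {e} {ρ} {i} {n} i<x n<b rep j j<x with i ≟ j
    ... | yes refl = trans (update-same ρ i n) (sym (digit-override-same {e = e} n<b i<x))
    ... | no i≢j   = trans (update-other ρ i j n i≢j) (trans (rep j j<x)
                       (sym (digit-override-other {e = e} n<b j<x
                         (i≢j ∘ sym ∘ var-injective ∘ ⌜⌝ᵗ-injective))))

    value-fold : ∀ {e ρ} → Represents e ρ → ∀ t → ⌜ t ⌝ᵗ < x → Value.fold (e ∷ xs) t ≡ value ρ t
    value-fold rep (var i)  i< = sym (rep i i<)
    value-fold rep 0ᵗ       t< = refl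
    value-fold rep 1ᵗ       t< = refl
    value-fold rep (t +ᵗ s) t< = cong₂ _+_
      (value-fold rep t (<-trans (proj₁ (+-increasing t s)) t<))
      (value-fold rep s (<-trans (proj₂ (+-increasing t s)) t<))
    value-fold rep (t ×ᵗ s) t< = cong₂ _*_
      (value-fold rep t (<-trans (proj₁ (×-increasing t s)) t<))
      (value-fold rep s (<-trans (proj₂ (×-increasing t s)) t<))

    -- Quantifying over all represented assignments absorbs the freedom at codes from x on, so it
    -- need not be shown that truth depends only on the variables that occur.
    Denotes : ℕ → ℕ → ℕ → Set
    Denotes c e w =
      ∃[ θ ] (IsΔ₀ θ × c ≡ ⌜ θ ⌝ × (∀ ρ → Represents e ρ → (ρ ⊨ θ) DecidedBy w))

    HasValue : ℕ → ℕ → ℕ → Set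
    HasValue c e u = ∃[ t ] (c ≡ ⌜ t ⌝ᵗ × (∀ ρ → Represents e ρ → value ρ t ≡ u))

    value-sound : ∀ {c e u} → c < x → ⟪ Value.Graph ⟫ (u ∷ c ∷ e ∷ xs) → HasValue c e u
    value-sound {c} {e} {u} c<x graph = read (Value.Graph-sound (e ∷ xs) (<-wellFounded c) graph)
      where
      read : ∃[ t ] (c ≡ ⌜ t ⌝ᵗ × u ≡ Value.fold (e ∷ xs) t) → HasValue c e u
      read (t , c≡ , u≡) = t , c≡ , λ ρ rep →
        sym (trans u≡ (value-fold rep t (subst (_< x) c≡ c<x)))

    denotes-¬ : ∀ {y e u} → Denotes y e u → Denotes (eval (proj₁ ¬-code) (y ∷ [])) e (1 ∸ u)
    denotes-¬ (A , δ , refl , truth) = (¬ᶠ A) , neg δ , proj₂ ¬-code A ,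
      λ ρ rep → decided-¬ (truth ρ rep)

    module _ {y z e u v : ℕ} where

      denotes-≐ : ∀ {w} → (u ≡ v) DecidedBy w → HasValue y e u → HasValue z e v →
                  Denotes (eval (proj₁ ≐-code) (y ∷ z ∷ [])) e w
      denotes-≐ {w} d (t , refl , t≡) (s , refl , s≡) = (t ≐ s) , IsΔ₀.eq t s , proj₂ ≐-code t s ,
        λ ρ rep → subst₂ (λ j k → (j ≡ k) DecidedBy w) (sym (t≡ ρ rep)) (sym (s≡ ρ rep)) d

      denotes-≤ : ∀ {w} → (u ≤ v) DecidedBy w → HasValue y e u → HasValue z e v →
                  Denotes (eval (proj₁ ≤-code) (y ∷ z ∷ [])) e w
      denotes-≤ {w} d (t , refl , t≡) (s , refl , s≡) = (t ≤ᶠ s) , IsΔ₀.leq t s , proj₂ ≤-code t s ,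
        λ ρ rep → subst₂ (λ j k → (j ≤ k) DecidedBy w) (sym (t≡ ρ rep)) (sym (s≡ ρ rep)) d

      denotes-∧ : Denotes y e u → Denotes z e v →
                  Denotes (eval (proj₁ ∧-code) (y ∷ z ∷ [])) e (u * v)
      denotes-∧ (A , δ , refl , truth) (B , δ′ , refl , truth′) =
        (A ∧ᶠ B) , and δ δ′ , proj₂ ∧-code A B , λ ρ rep → decided-× (truth ρ rep) (truth′ ρ rep)

      denotes-∨ : Denotes y e u → Denotes z e v →
                  Denotes (eval (proj₁ ∨-code) (y ∷ z ∷ [])) e (1 ∸ (1 ∸ u) * (1 ∸ v))
      denotes-∨ (A , δ , refl , truth) (B , δ′ , refl , truth′) =
        (A ∨ᶠ B) , or δ δ′ , proj₂ ∨-code A B , λ ρ rep → decided-⊎ (truth ρ rep) (truth′ ρ rep)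

      denotes-⇒ : Denotes y e u → Denotes z e v →
                  Denotes (eval (proj₁ ⇒-code) (y ∷ z ∷ [])) e (1 ∸ u * (1 ∸ v))
      denotes-⇒ (A , δ , refl , truth) (B , δ′ , refl , truth′) =
        (A ⇒ᶠ B) , imp δ δ′ , proj₂ ⇒-code A B , λ ρ rep → decided-→ (truth ρ rep) (truth′ ρ rep)

    module _ {q e u : ℕ} (i : ℕ) (t : Term) (i<x : ⌜ var i ⌝ᵗ < x) (i∉t : ¬ OccursIn i t)
             (u<b : u < b) (t≡u : ∀ ρ → Represents e ρ → value ρ t ≡ u) where

      private
        Instance : ℕ → ℕ → Set
        Instance k n = Denotes q (e [ ⌜ var i ⌝ᵗ ≔ n ]ᵉ) k

        Settled : Formula → ℕ → ℕ → Set
        Settled θ k n = ∀ ρ → Represents e ρ → n ≤ value ρ t × (ρ [ i ↦ n ] ⊨ θ) DecidedBy k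

        -- The formula delivered by the instance at n is a priori another one than θ; both have code
        -- q, so injectivity identifies them.
        settle : ∀ {θ k n} → n < suc u → q ≡ ⌜ θ ⌝ → Instance k n → Settled θ k n
        settle {k = k} {n} n<1+u q≡ (θ′ , _ , q≡′ , truth) ρ rep =
          subst (n ≤_) (sym (t≡u ρ rep)) (s≤s⁻¹ n<1+u) ,
          subst (λ θ → (ρ [ i ↦ n ] ⊨ θ) DecidedBy k) (⌜⌝-injective (trans (sym q≡′) q≡))
            (truth (ρ [ i ↦ n ]) (Represents-update i<x (≤-<-trans (s≤s⁻¹ n<1+u) u<b) rep))

        All-settled Any-settled : ℕ → Set
        All-settled k = ∃[ θ ] (IsΔ₀ θ × q ≡ ⌜ θ ⌝ × (∀ ρ → Represents e ρ →
                          ∀ n → n ≤ value ρ t → (ρ [ i ↦ n ] ⊨ θ) DecidedBy k))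
        Any-settled k = ∃[ θ ] (IsΔ₀ θ × q ≡ ⌜ θ ⌝ × (∀ ρ → Represents e ρ →
                          ∃[ n ] (n ≤ value ρ t × (ρ [ i ↦ n ] ⊨ θ) DecidedBy k)))

        all-settled : ∀ {k} → (∀ n → n < suc u → Instance k n) → All-settled k
        -- The range n < suc u is never empty, so the instance at 0 shows that q is the code of a
        -- formula.
        all-settled {k} instances = read (instances 0 (s≤s z≤n))
          where
          read : Instance k 0 → All-settled k
          read (θ , δ , q≡ , _) = θ , δ , q≡ , λ ρ rep n n≤ →
            let n<1+u = s≤s (subst (n ≤_) (t≡u ρ rep) n≤)
            in proj₂ (settle n<1+u q≡ (instances n n<1+u) ρ rep)

        any-settled : ∀ {k} → ∃[ n ] (n < suc u × Instance k n) → Any-settled k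
        any-settled (n , n<1+u , inst@(θ , δ , q≡ , _)) = θ , δ , q≡ , λ ρ rep →
          n , settle n<1+u q≡ inst ρ rep

      denotes-∀-true : (∀ n → n < suc u → Instance 1 n) →
        Denotes (eval (proj₁ ∀≤-code) (⌜ var i ⌝ᵗ ∷ ⌜ t ⌝ᵗ ∷ q ∷ [])) e 1
      denotes-∀-true instances = read (all-settled instances)
        where
        read : All-settled 1 → _
        read (θ , δ , refl , truth) = ∀≤ i t θ , all i∉t δ , proj₂ ∀≤-code i t θ i∉t , λ ρ rep →
          inj₁ (refl , Equivalence.to (⊨-∀≤ θ i∉t) (λ n n≤ → decided-1 (truth ρ rep n n≤)))

      denotes-∀-false : ∃[ n ] (n < suc u × Instance 0 n) →
        Denotes (eval (proj₁ ∀≤-code) (⌜ var i ⌝ᵗ ∷ ⌜ t ⌝ᵗ ∷ q ∷ [])) e 0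
      denotes-∀-false instances = read (any-settled instances)
        where
        read : Any-settled 0 → _
        read (θ , δ , refl , truth) = ∀≤ i t θ , all i∉t δ , proj₂ ∀≤-code i t θ i∉t , λ ρ rep →
          let n , n≤ , d = truth ρ rep
          in inj₂ (refl , λ p → decided-0 d (Equivalence.from (⊨-∀≤ θ i∉t) p n n≤))

      denotes-∃-true : ∃[ n ] (n < suc u × Instance 1 n) →
        Denotes (eval (proj₁ ∃≤-code) (⌜ var i ⌝ᵗ ∷ ⌜ t ⌝ᵗ ∷ q ∷ [])) e 1
      denotes-∃-true instances = read (any-settled instances)
        where
        read : Any-settled 1 → _
        read (θ , δ , refl , truth) = ∃≤ i t θ , ex i∉t δ , proj₂ ∃≤-code i t θ i∉t , λ ρ rep →
          let n , n≤ , d = truth ρ rep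
          in inj₁ (refl , Equivalence.to (⊨-∃≤ θ i∉t) (n , n≤ , decided-1 d))

      denotes-∃-false : (∀ n → n < suc u → Instance 0 n) →
        Denotes (eval (proj₁ ∃≤-code) (⌜ var i ⌝ᵗ ∷ ⌜ t ⌝ᵗ ∷ q ∷ [])) e 0
      denotes-∃-false instances = read (all-settled instances)
        where
        read : All-settled 0 → _
        read (θ , δ , refl , truth) = ∃≤ i t θ , ex i∉t δ , proj₂ ∃≤-code i t θ i∉t , λ ρ rep →
          inj₂ (refl , λ p → let n , n≤ , holds = Equivalence.from (⊨-∃≤ θ i∉t) p
                             in decided-0 (truth ρ rep n n≤) holds)

    private
      History : ℕ → ℕ
      History c = ⟦ history ⟧ (c ∷ xs)

      IH : ℕ → Set
      IH c = ∀ {q e k} → q < c → e < b ^ x → k < 2 →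
             ⟦ bitAt ⟧ (b ^ x ∷ 2 ∷ History c ∷ q ∷ e ∷ k ∷ []) ≡ 1 → Denotes q e k

      along : ∀ {c c′ e w w′} → c ≡ c′ → w ≡ w′ → Denotes c′ e w′ → Denotes c e w
      along refl refl d = d

      atomic-sound : ∀ {c e w} → c ≤ x → ⟪ atomic ⟫ (w ∷ e ∷ c ∷ History c ∷ xs) → Denotes c e w
      atomic-sound {w = w} c≤x (y , y< , z , z< , u , u< , v , v< , gy , gz , inj₁ (c≡ , w≡)) =
        along {w = w} c≡ refl (denotes-≐
          (subst ((u ≡ v) DecidedBy_) (sym w≡) (decides (arg 1F == arg 0F) (v ∷ u ∷ [])))
          (value-sound (<-≤-trans y< c≤x) gy) (value-sound (<-≤-trans z< c≤x) gz))
      atomic-sound {w = w} c≤x (y , y< , z , z< , u , u< , v , v< , gy , gz , inj₂ (c≡ , w≡)) =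
        along {w = w} c≡ refl (denotes-≤
          (subst ((u ≤ v) DecidedBy_) (sym w≡) (decides (arg 1F ≼ arg 0F) (v ∷ u ∷ [])))
          (value-sound (<-≤-trans y< c≤x) gy) (value-sound (<-≤-trans z< c≤x) gz))

      negation-sound : ∀ {c e w} → IH c → e < b ^ x →
        ⟪ negation ⟫ (w ∷ e ∷ c ∷ History c ∷ xs) → Denotes c e w
      negation-sound ih e< (y , y< , u , u< , yu , c≡ , w≡) =
        along c≡ w≡ (denotes-¬ (ih y< e< u< yu))

      binary-sound : ∀ {c e w} → IH c → e < b ^ x →
        ⟪ binary ⟫ (w ∷ e ∷ c ∷ History c ∷ xs) → Denotes c e w
      binary-sound ih e< (y , y< , z , z< , u , u< , v , v< , yu , zv , inj₁ (c≡ , w≡)) =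
        along c≡ w≡ (denotes-∧ (ih y< e< u< yu) (ih z< e< v< zv))
      binary-sound ih e< (y , y< , z , z< , u , u< , v , v< , yu , zv , inj₂ (inj₁ (c≡ , w≡))) =
        along c≡ w≡ (denotes-∨ (ih y< e< u< yu) (ih z< e< v< zv))
      binary-sound ih e< (y , y< , z , z< , u , u< , v , v< , yu , zv , inj₂ (inj₂ (c≡ , w≡))) =
        along c≡ w≡ (denotes-⇒ (ih y< e< u< yu) (ih z< e< v< zv))

      -- The clause for the quantifiers once the codes of its variable y and its term z are decoded.
      Quantifier : (c e w y z q u : ℕ) → Set
      Quantifier c e w y z q u =
          (c ≡ eval (proj₁ ∀≤-code) (y ∷ z ∷ q ∷ []) ×
            ((w ≡ 1 × (∀ n → n < suc u → Instance 1 n)) ⊎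
             (w ≡ 0 × ∃[ n ] (n < suc u × Instance 0 n))))
        ⊎ (c ≡ eval (proj₁ ∃≤-code) (y ∷ z ∷ q ∷ []) ×
            ((w ≡ 1 × ∃[ n ] (n < suc u × Instance 1 n)) ⊎
             (w ≡ 0 × (∀ n → n < suc u → Instance 0 n))))
        where
        Instance : ℕ → ℕ → Set
        Instance k n = ⟦ bitAt ⟧ (b ^ x ∷ 2 ∷ History c ∷ q ∷ (e [ y ≔ n ]ᵉ) ∷ k ∷ []) ≡ 1

      quantifier-sound : ∀ {c e w y z q u} → c ≤ x → IH c → y < c → q < c → u < b →
        ∃[ i ] (y ≡ ⌜ var i ⌝ᵗ) → ∃[ t ] (z ≡ ⌜ t ⌝ᵗ × 1 ≡ NonOccurrence.fold (y ∷ []) t) →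
        HasValue z e u →
        Quantifier c e w y z q u → Denotes c e w
      quantifier-sound {c} {e} {w} {q = q} {u = u} c≤x ih y<c q<c u<b
        (i , refl) (t , refl , absent) (t′ , z≡ , t′≡u) = λ where
          (inj₁ (c≡ , inj₁ (w≡ , insts))) →
            along c≡ w≡ (denotes-∀-true i t i<x i∉t u<b t≡u
              (λ n n< → inst n< (s≤s (s≤s z≤n)) (insts n n<)))
          (inj₁ (c≡ , inj₂ (w≡ , n , n< , i₀))) →
            along c≡ w≡ (denotes-∀-false i t i<x i∉t u<b t≡u (n , n< , inst n< (s≤s z≤n) i₀))
          (inj₂ (c≡ , inj₁ (w≡ , n , n< , i₁))) →
            along c≡ w≡ (denotes-∃-true i t i<x i∉t u<b t≡u (n , n< , inst n< (s≤s (s≤s z≤n)) i₁))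
          (inj₂ (c≡ , inj₂ (w≡ , insts))) →
            along c≡ w≡ (denotes-∃-false i t i<x i∉t u<b t≡u
              (λ n n< → inst n< (s≤s z≤n) (insts n n<)))
        where
        i<x : ⌜ var i ⌝ᵗ < x
        i<x = <-≤-trans y<c c≤x
        i∉t : ¬ OccursIn i t
        i∉t = absent⇒∉ i t (sym absent)
        -- The occurrence test and the evaluation each decode z into a term; injectivity makes these
        -- terms equal.
        t≡u : ∀ ρ → Represents e ρ → value ρ t ≡ u
        t≡u ρ rep = trans (cong (value ρ) (⌜⌝ᵗ-injective z≡)) (t′≡u ρ rep)
        inst : ∀ {n k} → n < suc u → k < 2 →
          ⟦ bitAt ⟧ (b ^ x ∷ 2 ∷ History c ∷ q ∷ (e [ ⌜ var i ⌝ᵗ ≔ n ]ᵉ) ∷ k ∷ []) ≡ 1 →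
          Denotes q (e [ ⌜ var i ⌝ᵗ ≔ n ]ᵉ) k
        inst n< k< = ih q<c (override< (≤-<-trans (s≤s⁻¹ n<) u<b)) k<

      quantified-sound : ∀ {c e w} → c ≤ x → IH c →
        ⟪ quantified ⟫ (w ∷ e ∷ c ∷ History c ∷ xs) → Denotes c e w
      quantified-sound c≤x ih
        (y , y< , z , z< , q , q< , u , u< , is-var , absent , gz , clause) =
        quantifier-sound c≤x ih y< q< u< is-var
          (NonOccurrence.Graph-sound (y ∷ []) (<-wellFounded z) absent)
          (value-sound (<-≤-trans z< c≤x) gz) clause

    -- The condition c ≤ x keeps the codes of all variables met below x. The clauses search only for
    -- values below `b`, so updated assignments stay below b ^ x, where lookups are valid.
    Truth-sound : ∀ {c e w} → Acc _<_ c → c ≤ x → e < b ^ x →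
                  ⟪ Truth ⟫ (w ∷ e ∷ c ∷ xs) → Denotes c e w
    Truth-sound {c} {e} {w} (acc smaller) c≤x e< = λ where
        (inj₁ clause)               → atomic-sound c≤x clause
        (inj₂ (inj₁ clause))        → negation-sound ih e< clause
        (inj₂ (inj₂ (inj₁ clause))) → binary-sound ih e< clause
        (inj₂ (inj₂ (inj₂ clause))) → quantified-sound c≤x ih clause
      where
      ih : IH c
      ih q<c e′< k< recall = Truth-sound (smaller q<c) (≤-trans (<⇒≤ q<c) c≤x) e′<
        (Equivalence.to (recall-history xs q<c e′< k<) recall)

    -- Bounds during evaluation, and completeness of the truth relation

    lev : ℕ → ℕ
    lev m = ⟦ level ⟧ (m ∷ a ∷ [])

    lev<b : ∀ {m v} → m ≤ x * x → v ≤ lev m → v < b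
    lev<b m≤ v≤ = subst (_ <_) (sym (⟦base⟧ x a)) (s≤s (≤-trans v≤ (level-mono a m≤)))

    Bounded : ℕ → ℕ → Set
    Bounded m e = ∀ j → j < x → digit b j e ≤ lev m

    private
      -- Both operands have codes below c, so they are bounded one iteration before m + c, and the
      -- last iteration absorbs the operation.
      grow : ∀ {m p q c u v} (_∙_ : ℕ → ℕ → ℕ) → (∀ {i j k l} → i ≤ j → k ≤ l → i ∙ k ≤ j ∙ l) →
             (∀ m → lev m ∙ lev m ≤ lev (suc m)) →
             p < c → q < c → u ≤ lev (m + p) → v ≤ lev (m + q) → u ∙ v ≤ lev (m + c)
      grow {m} {c = suc c} _∙_ mono step p<c q<c u≤ v≤ = ≤-trans
        (mono (≤-trans u≤ (level-mono a (+-monoʳ-≤ m (s≤s⁻¹ p<c))))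
              (≤-trans v≤ (level-mono a (+-monoʳ-≤ m (s≤s⁻¹ q<c)))))
        (subst (λ k → lev (m + c) ∙ lev (m + c) ≤ lev k) (sym (+-suc m c)) (step (m + c)))

    fold-bounded : ∀ {m e} → Bounded m e → ∀ t → ⌜ t ⌝ᵗ < x →
                   Value.fold (e ∷ xs) t ≤ lev (m + ⌜ t ⌝ᵗ)
    fold-bounded {m} bounded (var i) i<x = ≤-trans (bounded _ i<x) (level-mono a (m≤m+n m _))
    fold-bounded bounded 0ᵗ _ = z≤n
    fold-bounded {m} bounded 1ᵗ _ = ≤-trans (s≤s z≤n) (level-positive (m + ⌜ 1ᵗ ⌝ᵗ) a)
    fold-bounded bounded (t +ᵗ s) ts<x = grow _+_ +-mono-≤ (λ m → level-+ m a) t< s<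
      (fold-bounded bounded t (<-trans t< ts<x)) (fold-bounded bounded s (<-trans s< ts<x))
      where
      t< : ⌜ t ⌝ᵗ < ⌜ t +ᵗ s ⌝ᵗ
      t< = proj₁ (+-increasing t s)
      s< : ⌜ s ⌝ᵗ < ⌜ t +ᵗ s ⌝ᵗ
      s< = proj₂ (+-increasing t s)
    fold-bounded bounded (t ×ᵗ s) ts<x = grow _*_ *-mono-≤ (λ m → level-* m a) t< s<
      (fold-bounded bounded t (<-trans t< ts<x)) (fold-bounded bounded s (<-trans s< ts<x))
      where
      t< : ⌜ t ⌝ᵗ < ⌜ t ×ᵗ s ⌝ᵗ
      t< = proj₁ (×-increasing t s)
      s< : ⌜ s ⌝ᵗ < ⌜ t ×ᵗ s ⌝ᵗ
      s< = proj₂ (×-increasing t s)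

    -- Below a subformula with code c, an assignment with values at most lev m leads to values of
    -- at most lev (m + x * c): every quantifier crossed raises m by at most x and lowers c.
    Budget : ℕ → ℕ → Set
    Budget m c = c ≤ x × m + x * c ≤ x * x

    budget-< : ∀ {m c p} → p < c → Budget m c → Budget m p
    budget-< {m} p<c (c≤x , within) =
      ≤-trans (<⇒≤ p<c) c≤x , ≤-trans (+-monoʳ-≤ m (*-monoʳ-≤ x (<⇒≤ p<c))) within

    budget-quantifier : ∀ {m c p} → p < c → Budget m c → Budget (m + x) p
    budget-quantifier {m} {c} {p} p<c (c≤x , within) = ≤-trans (<⇒≤ p<c) c≤x , (begin
      m + x + x * p    ≡⟨ +-assoc m x (x * p) ⟩
      m + (x + x * p)  ≡⟨ cong (m +_) (*-suc x p) ⟨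
      m + x * suc p    ≤⟨ +-monoʳ-≤ m (*-monoʳ-≤ x p<c) ⟩
      m + x * c        ≤⟨ within ⟩
      x * x            ∎)
      where open ≤-Reasoning

    budget-value : ∀ {m c p} → p < c → Budget m c → m + p ≤ x * x
    budget-value {m} {c@(suc _)} {p} p<c (c≤x , within) =
      -- A code p < c is at most x, hence at most x * c because c is positive; so the budget also
      -- covers the evaluation of a term.
      ≤-trans (+-monoʳ-≤ m (≤-trans (<⇒≤ (<-≤-trans p<c c≤x)) (m≤m*n x c))) within

    module _ {m c e : ℕ} (budget : Budget m c) (bounded : Bounded m e)
             (t : Term) (t<c : ⌜ t ⌝ᵗ < c) where

      private
        fold<b : ∀ s → ⌜ s ⌝ᵗ ≤ ⌜ t ⌝ᵗ → Value.fold (e ∷ xs) s < b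
        fold<b s s≤t = lev<b (budget-value s<c budget)
            (fold-bounded bounded s (<-≤-trans s<c (proj₁ budget)))
          where
          s<c : ⌜ s ⌝ᵗ < c
          s<c = ≤-<-trans s≤t t<c

      value< : Value.fold (e ∷ xs) t < b
      value< = fold<b t ≤-refl

      value-complete : ⟪ Value.Graph ⟫ (Value.fold (e ∷ xs) t ∷ ⌜ t ⌝ᵗ ∷ e ∷ xs)
      value-complete = Value.Graph-complete (e ∷ xs) t fold<b

    Evaluated : ℕ → ℕ → Set
    Evaluated c e = ∃[ w ] (w < 2 × ⟪ Truth ⟫ (w ∷ e ∷ c ∷ xs))

    private
      past : ∀ {c q e w} → q < c → e < b ^ x → w < 2 → ⟪ Truth ⟫ (w ∷ e ∷ q ∷ xs) →
             ⟦ bitAt ⟧ (b ^ x ∷ 2 ∷ History c ∷ q ∷ e ∷ w ∷ []) ≡ 1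
      past q<c e< w<2 = Equivalence.from (recall-history xs q<c e< w<2)

      binary-complete : ∀ {c e} B C → e < b ^ x → ⌜ B ⌝ < c → ⌜ C ⌝ < c →
        (f : ℕ → ℕ → ℕ) → (∀ {u v} → u < 2 → v < 2 → f u v < 2) →
        (∀ u v →
          (c ≡ eval (proj₁ ∧-code) (⌜ B ⌝ ∷ ⌜ C ⌝ ∷ []) × f u v ≡ u * v) ⊎
          (c ≡ eval (proj₁ ∨-code) (⌜ B ⌝ ∷ ⌜ C ⌝ ∷ []) × f u v ≡ 1 ∸ (1 ∸ u) * (1 ∸ v)) ⊎
          (c ≡ eval (proj₁ ⇒-code) (⌜ B ⌝ ∷ ⌜ C ⌝ ∷ []) × f u v ≡ 1 ∸ u * (1 ∸ v))) →
        Evaluated ⌜ B ⌝ e → Evaluated ⌜ C ⌝ e → Evaluated c e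
      binary-complete B C e< B<c C<c f f<2 clause (u , u<2 , tu) (v , v<2 , tv) =
        f u v , f<2 u<2 v<2 , inj₂ (inj₂ (inj₁
          ( ⌜ B ⌝ , B<c , ⌜ C ⌝ , C<c , u , u<2 , v , v<2
          , past B<c e< u<2 tu , past C<c e< v<2 tv , clause u v)))

      Past : (c e y q k n : ℕ) → Set
      Past c e y q k n = ⟦ bitAt ⟧ (b ^ x ∷ 2 ∷ History c ∷ q ∷ (e [ y ≔ n ]ᵉ) ∷ k ∷ []) ≡ 1

      module _ {m c e} (budget : Budget m c) (bounded : Bounded m e)
               (i : ℕ) (t : Term) (A : Formula) (i∉t : ¬ OccursIn i t)
               (i<c : ⌜ var i ⌝ᵗ < c) (t<c : ⌜ t ⌝ᵗ < c) (A<c : ⌜ A ⌝ < c)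
               (evaluated : ∀ {e} → e < b ^ x → Bounded (m + x) e → Evaluated ⌜ A ⌝ e) where

        u : ℕ
        u = Value.fold (e ∷ xs) t

        bounded-update : ∀ n → n < suc u → Bounded (m + x) (e [ ⌜ var i ⌝ᵗ ≔ n ]ᵉ)
        bounded-update n n< j j<x = case j ≟ ⌜ var i ⌝ᵗ of λ where
            (yes refl) → subst (_≤ lev (m + x)) (sym (digit-override-same {e = e} n<b j<x)) n≤
            (no j≢)    → subst (_≤ lev (m + x)) (sym (digit-override-other {e = e} n<b j<x j≢))
                           (≤-trans (bounded j j<x) (level-mono a (m≤m+n m x)))
          where
          n<b : n < b
          n<b = ≤-<-trans (s≤s⁻¹ n<) (value< budget bounded t t<c)
          -- The bounding term has a code below x and so costs at most x iterations: this is the x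
          -- charged for each quantifier.
          n≤ : n ≤ lev (m + x)
          n≤ = ≤-trans (s≤s⁻¹ n<) (≤-trans (fold-bounded bounded t (<-≤-trans t<c (proj₁ budget)))
            (level-mono a (+-monoʳ-≤ m (<⇒≤ (<-≤-trans t<c (proj₁ budget))))))

        instances : ∀ n → n < suc u →
                    Past c e ⌜ var i ⌝ᵗ ⌜ A ⌝ 1 n ⊎ Past c e ⌜ var i ⌝ᵗ ⌜ A ⌝ 0 n
        instances n n< = classify (evaluated e′< (bounded-update n n<))
          where
          e′< : (e [ ⌜ var i ⌝ᵗ ≔ n ]ᵉ) < b ^ x
          e′< = override< (≤-<-trans (s≤s⁻¹ n<) (value< budget bounded t t<c))
          classify : Evaluated ⌜ A ⌝ (e [ ⌜ var i ⌝ᵗ ≔ n ]ᵉ) →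
                     Past c e ⌜ var i ⌝ᵗ ⌜ A ⌝ 1 n ⊎ Past c e ⌜ var i ⌝ᵗ ⌜ A ⌝ 0 n
          classify (0 , w<2 , truth) = inj₂ (past A<c e′< w<2 truth)
          classify (1 , w<2 , truth) = inj₁ (past A<c e′< w<2 truth)
          classify (suc (suc _) , s≤s (s≤s ()) , _)

        quantified-complete : ∀ {w} → w < 2 →
          Quantifier c e w ⌜ var i ⌝ᵗ ⌜ t ⌝ᵗ ⌜ A ⌝ u → Evaluated c e
        quantified-complete {w} w<2 clause = w , w<2 , inj₂ (inj₂ (inj₂
          ( ⌜ var i ⌝ᵗ , i<c , ⌜ t ⌝ᵗ , t<c , ⌜ A ⌝ , A<c , u , value< budget bounded t t<c
          , (i , refl) , absent , value-complete budget bounded t t<c , clause)))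
          where
          absent : ⟪ NonOccurrence.Graph ⟫ (1 ∷ ⌜ t ⌝ᵗ ∷ ⌜ var i ⌝ᵗ ∷ [])
          absent = subst (λ k → ⟪ NonOccurrence.Graph ⟫ (k ∷ ⌜ t ⌝ᵗ ∷ ⌜ var i ⌝ᵗ ∷ [])) (∉⇒absent i t i∉t)
            (NonOccurrence.Graph-complete (⌜ var i ⌝ᵗ ∷ []) t (λ s _ → mark<2 i s))

        ∀≤-complete : c ≡ ⌜ ∀≤ i t A ⌝ → Evaluated c e
        ∀≤-complete c≡ = decide (every-or-some (suc u) instances)
          where
          c≡′ : c ≡ eval (proj₁ ∀≤-code) (⌜ var i ⌝ᵗ ∷ ⌜ t ⌝ᵗ ∷ ⌜ A ⌝ ∷ [])
          c≡′ = trans c≡ (sym (proj₂ ∀≤-code i t A i∉t))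
          decide : (∀ n → n < suc u → Past c e ⌜ var i ⌝ᵗ ⌜ A ⌝ 1 n) ⊎
                   (∃[ n ] (n < suc u × Past c e ⌜ var i ⌝ᵗ ⌜ A ⌝ 0 n)) → Evaluated c e
          decide (inj₁ every) = quantified-complete (s≤s (s≤s z≤n)) (inj₁ (c≡′ , inj₁ (refl , every)))
          decide (inj₂ some)  = quantified-complete (s≤s z≤n) (inj₁ (c≡′ , inj₂ (refl , some)))

        ∃≤-complete : c ≡ ⌜ ∃≤ i t A ⌝ → Evaluated c e
        ∃≤-complete c≡ = decide (every-or-some (suc u) (λ n n< → swap (instances n n<)))
          where
          c≡′ : c ≡ eval (proj₁ ∃≤-code) (⌜ var i ⌝ᵗ ∷ ⌜ t ⌝ᵗ ∷ ⌜ A ⌝ ∷ [])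
          c≡′ = trans c≡ (sym (proj₂ ∃≤-code i t A i∉t))
          decide : (∀ n → n < suc u → Past c e ⌜ var i ⌝ᵗ ⌜ A ⌝ 0 n) ⊎
                   (∃[ n ] (n < suc u × Past c e ⌜ var i ⌝ᵗ ⌜ A ⌝ 1 n)) → Evaluated c e
          decide (inj₁ every) = quantified-complete (s≤s z≤n) (inj₂ (c≡′ , inj₂ (refl , every)))
          decide (inj₂ some)  = quantified-complete (s≤s (s≤s z≤n)) (inj₂ (c≡′ , inj₁ (refl , some)))

      atomic-complete : ∀ {m c e} → Budget m c → Bounded m e → ∀ t s → ⌜ t ⌝ᵗ < c → ⌜ s ⌝ᵗ < c →
        ∀ {w} → w < 2 → let u = Value.fold (e ∷ xs) t ; v = Value.fold (e ∷ xs) s in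
        (c ≡ eval (proj₁ ≐-code) (⌜ t ⌝ᵗ ∷ ⌜ s ⌝ᵗ ∷ []) ×
          w ≡ ⟦ χ (arg 1F == arg 0F) ⟧ (v ∷ u ∷ [])) ⊎
        (c ≡ eval (proj₁ ≤-code) (⌜ t ⌝ᵗ ∷ ⌜ s ⌝ᵗ ∷ []) ×
          w ≡ ⟦ χ (arg 1F ≼ arg 0F) ⟧ (v ∷ u ∷ [])) →
        Evaluated c e
      atomic-complete budget bounded t s t<c s<c {w} w<2 clause = w , w<2 , inj₁
        ( ⌜ t ⌝ᵗ , t<c , ⌜ s ⌝ᵗ , s<c
        , _ , value< budget bounded t t<c , _ , value< budget bounded s s<c
        , value-complete budget bounded t t<c , value-complete budget bounded s s<c , clause)

      negation-complete : ∀ {e} A → e < b ^ x → Evaluated ⌜ A ⌝ e → Evaluated ⌜ ¬ᶠ A ⌝ e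
      negation-complete A e< (u , u<2 , truth) = 1 ∸ u , 1∸<2 u , inj₂ (inj₁
        ( ⌜ A ⌝ , ¬-increasing A , u , u<2 , past (¬-increasing A) e< u<2 truth
        , sym (proj₂ ¬-code A) , refl))

    Truth-complete : ∀ {A} → IsΔ₀ A → ∀ {m e} → Budget m ⌜ A ⌝ → e < b ^ x →
                     Bounded m e → Evaluated ⌜ A ⌝ e
    Truth-complete (eq t s) {e = e} budget e< bounded =
      atomic-complete budget bounded t s (proj₁ (≐-increasing t s)) (proj₂ (≐-increasing t s))
        (decided<2 (decides (arg 1F == arg 0F) (Value.fold (e ∷ xs) s ∷ Value.fold (e ∷ xs) t ∷ [])))
        (inj₁ (sym (proj₂ ≐-code t s) , refl))
    Truth-complete (leq t s) {e = e} budget e< bounded =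
      atomic-complete budget bounded t s (proj₁ (≤-increasing t s)) (proj₂ (≤-increasing t s))
        (decided<2 (decides (arg 1F ≼ arg 0F) (Value.fold (e ∷ xs) s ∷ Value.fold (e ∷ xs) t ∷ [])))
        (inj₂ (sym (proj₂ ≤-code t s) , refl))
    Truth-complete (neg {A} δ) {m} budget e< bounded = negation-complete A e<
      (Truth-complete δ (budget-< {m} (¬-increasing A) budget) e< bounded)
    Truth-complete (and {A} {B} δ δ′) {m} budget e< bounded =
      binary-complete A B e< A< B< _*_ *<2 (λ u v → inj₁ (sym (proj₂ ∧-code A B) , refl))
        (Truth-complete δ (budget-< {m} A< budget) e< bounded)
        (Truth-complete δ′ (budget-< {m} B< budget) e< bounded)
      where
      A< : ⌜ A ⌝ < ⌜ A ∧ᶠ B ⌝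
      A< = proj₁ (∧-increasing A B)
      B< : ⌜ B ⌝ < ⌜ A ∧ᶠ B ⌝
      B< = proj₂ (∧-increasing A B)
    Truth-complete (or {A} {B} δ δ′) {m} budget e< bounded =
      binary-complete A B e< A< B< (λ u v → 1 ∸ (1 ∸ u) * (1 ∸ v))
        (λ {u} {v} _ _ → 1∸<2 ((1 ∸ u) * (1 ∸ v)))
        (λ u v → inj₂ (inj₁ (sym (proj₂ ∨-code A B) , refl)))
        (Truth-complete δ (budget-< {m} A< budget) e< bounded)
        (Truth-complete δ′ (budget-< {m} B< budget) e< bounded)
      where
      A< : ⌜ A ⌝ < ⌜ A ∨ᶠ B ⌝
      A< = proj₁ (∨-increasing A B)
      B< : ⌜ B ⌝ < ⌜ A ∨ᶠ B ⌝
      B< = proj₂ (∨-increasing A B)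
    Truth-complete (imp {A} {B} δ δ′) {m} budget e< bounded =
      binary-complete A B e< A< B< (λ u v → 1 ∸ u * (1 ∸ v)) (λ {u} {v} _ _ → 1∸<2 (u * (1 ∸ v)))
        (λ u v → inj₂ (inj₂ (sym (proj₂ ⇒-code A B) , refl)))
        (Truth-complete δ (budget-< {m} A< budget) e< bounded)
        (Truth-complete δ′ (budget-< {m} B< budget) e< bounded)
      where
      A< : ⌜ A ⌝ < ⌜ A ⇒ᶠ B ⌝
      A< = proj₁ (⇒-increasing A B)
      B< : ⌜ B ⌝ < ⌜ A ⇒ᶠ B ⌝
      B< = proj₂ (⇒-increasing A B)
    Truth-complete (all {i} {t} {A} i∉t δ) {m} budget e< bounded =
      ∀≤-complete budget bounded i t A i∉t (proj₁ inc) (proj₁ (proj₂ inc)) A<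
        (Truth-complete δ (budget-quantifier {m} A< budget)) refl
      where
      inc : ⌜ var i ⌝ᵗ < ⌜ ∀≤ i t A ⌝ × ⌜ t ⌝ᵗ < ⌜ ∀≤ i t A ⌝ × ⌜ A ⌝ < ⌜ ∀≤ i t A ⌝
      inc = ∀≤-increasing i t A i∉t
      A< : ⌜ A ⌝ < ⌜ ∀≤ i t A ⌝
      A< = proj₂ (proj₂ inc)
    Truth-complete (ex {i} {t} {A} i∉t δ) {m} budget e< bounded =
      ∃≤-complete budget bounded i t A i∉t (proj₁ inc) (proj₁ (proj₂ inc)) A<
        (Truth-complete δ (budget-quantifier {m} A< budget)) refl
      where
      inc : ⌜ var i ⌝ᵗ < ⌜ ∃≤ i t A ⌝ × ⌜ t ⌝ᵗ < ⌜ ∃≤ i t A ⌝ × ⌜ A ⌝ < ⌜ ∃≤ i t A ⌝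
      inc = ∃≤-increasing i t A i∉t
      A< : ⌜ A ⌝ < ⌜ ∃≤ i t A ⌝
      A< = proj₂ (proj₂ inc)

    -- Satisfaction as an instance of the truth relation

    initial : ℕ
    initial = table b x (λ _ → a)

    private
      a<b : a < b
      a<b = lev<b z≤n (<⇒≤ (level-positive 0 a))

      digit-initial : ∀ j → j < x → digit b j initial ≡ a
      digit-initial = digit-table b x (λ _ → a) (λ _ _ → a<b)

      initial< : initial < b ^ x
      initial< = table< b x (λ _ → a) (λ _ _ → a<b)

    Truth-⇔ : ⟪ Truth ⟫ (1 ∷ initial ∷ x ∷ xs) ⇔ SatΔ₀ G (x ∷ a ∷ [])
    Truth-⇔ = mk⇔ (to ∘ Truth-sound (<-wellFounded x) ≤-refl initial<) from
      where
      represents : Represents initial (λ _ → a)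
      represents i i<x = sym (digit-initial _ i<x)
      to : Denotes x initial 1 → SatΔ₀ G (x ∷ a ∷ [])
      to (θ , δ , x≡ , truth) = θ , δ , x≡ ,
        Equivalence.to (Instantiation.True-instantiate a θ) (decided-1 (truth (λ _ → a) represents))
      from : SatΔ₀ G (x ∷ a ∷ []) → ⟪ Truth ⟫ (1 ∷ initial ∷ x ∷ xs)
      from (θ , δ , x≡ , true) = select (subst (λ c → Evaluated c initial) (sym x≡)
          -- At m = 0 and code x the budget is met with equality, which is where the x * x
          -- iterations in `base` come from.
          (Truth-complete δ {0} (≤-reflexive (sym x≡) , *-monoʳ-≤ x (≤-reflexive (sym x≡)))
            initial< bounded))
        where
        bounded : Bounded 0 initial
        bounded j j<x = ≤-trans (≤-reflexive (digit-initial j j<x)) (<⇒≤ (level-positive 0 a))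
        ¬false : ¬ Denotes x initial 0
        ¬false (θ′ , _ , x≡′ , truth) = decided-0 (truth (λ _ → a) represents)
          (subst ((λ _ → a) ⊨_) (⌜⌝-injective (trans (sym x≡) x≡′))
            (Equivalence.from (Instantiation.True-instantiate a θ) true))
        select : Evaluated x initial → ⟪ Truth ⟫ (1 ∷ initial ∷ x ∷ xs)
        select (0 , w<2 , truth) =
          contradiction (Truth-sound (<-wellFounded x) ≤-refl initial< truth) ¬false
        select (1 , w<2 , truth) = truth
        select (suc (suc _) , s≤s (s≤s ()) , _)

  -- The number x enters both as the code to evaluate and as a parameter that stays fixed while
  -- codes decrease. The initial assignment has digit a at every position below x, hence at every
  -- variable of the formula.
  Satisfaction : Rel 2
  Satisfaction = Truth [ const 1 ∷ tableᶠ base (arg 0F) (arg 2F) ∷ arg 0F ∷ arg 0F ∷ arg 1F ∷ [] ]ᴿ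

primitiveRecursiveRelation : (R : Rel n) {Q : Vec ℕ n → Set} → (∀ xs → ⟪ R ⟫ xs ⇔ Q xs) →
                             PrimitiveRecursiveRelation Q
primitiveRecursiveRelation R R⇔Q = ⟦ χ R ⟧
  , (λ xs → characteristic (decided-⇔ (R⇔Q xs) (decides R xs)))
  , prog (χ R) , correct (χ R)
  where
  characteristic : ∀ {P k} → P DecidedBy k → (k ≡ 0 ⊎ k ≡ 1) × (k ≡ 1 ⇔ P)
  characteristic d@(inj₁ (k≡1 , _)) = inj₂ k≡1 , decided⇒≡1⇔ d
  characteristic d@(inj₂ (k≡0 , _)) = inj₁ k≡0 , decided⇒≡1⇔ d

theorem2p7 : (G : GödelCoding) → PrimitiveRecursiveRelation (SatΔ₀ G)
theorem2p7 G = primitiveRecursiveRelation Satisfaction λ where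
    (x ∷ a ∷ []) → Correctness.Truth-⇔ x a
  where open Evaluation G
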